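{- Let $n,m\ge 2$ be integers and let $G=P_n\boxtimes P_m$ be the strong product of the paths $P_n$ and $P_m$ on $n$ and $m$ vertices. Then $G$ is just a frame graph in the inner product spaces of dimension $(n-1)(m-1),(n-1)(m-1)+1,\dots,mn-1,mn$; that is, for each $\mathbb{F}\in\{\mathbb{R},\mathbb{C}\}$ and each integer $d\ge 1$, $G$ is a frame graph in a $d$-dimensional inner product space over $\mathbb{F}$ if and only if $(n-1)(m-1)\le d\le mn$.
   Context: All graphs are finite, simple, connected and have more than one vertex. A finite frame for a finite-dimensional inner product space $\mathcal{H}$ over $\mathbb{R}$ or $\mathbb{C}$ is a finite sequence $\varphi=(f_i)_{i=1}^N$ in $\mathcal{H}$ for which there are constants $0<A\le B<\infty$ with $A\|f\|^2\le\sum_{i=1}^N|\langle f,f_i\rangle|^2\le B\|f\|^2$ for all $f\in\mathcal{H}$ (equivalently, a finite sequence spanning $\mathcal{H}$; repeated vectors are allowed and count as different vertices). Its frame graph $G(\varphi)$ has the elements $f_1,\dots,f_N$ of the sequence as vertices, and for $i\ne j$, $f_i$ and $f_j$ are adjacent iff $\langle f_i,f_j\rangle\ne 0$. A graph $G$ is a frame graph in $\mathcal{H}$ if there is a finite frame $\varphi$ for $\mathcal{H}$ with $G(\varphi)=G$ (up to labelling of vertices). The strong product $G_1\boxtimes G_2$ of $G_1=(V_1,E_1)$ and $G_2=(V_2,E_2)$ has vertex set $V_1\times V_2$, with $(u,v)$ adjacent to $(u',v')$ iff (1) $u=u'$ and $\{v,v'\}\in E_2$, or (2) $v=v'$ and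 $\{u,u'\}\in E_1$, or (3) $\{u,u'\}\in E_1$ and $\{v,v'\}\in E_2$. -}

module Defs where

open import Algebra.Bundles using (CommutativeRing; AbelianGroup)
import Algebra.Consequences.Setoid as Consequences
import Algebra.Construct.DirectProduct as DirectProduct
open import Algebra.Module.Bundles using (LeftModule)
import Algebra.Properties.AbelianGroup as AbelianGroupProperties
import Algebra.Properties.CommutativeMonoid.Sum as Summation
import Algebra.Properties.Ring as RingProperties
import Algebra.Solver.Ring.NaturalCoefficients.Default as SemiringSolver
open import Data.Fin.Base using (Fin; toℕ)
open import Data.Fin.Properties using (*↔×)
open import Data.Nat.Base using (ℕ; suc)
import Data.Nat.Properties as ℕₚ
open import Data.Product.Base using (Σ; ∃; _×_; _,_; proj₁; proj₂)
open import Data.Product.Function.NonDependent.Propositional using (_×-↔_)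
open import Data.Sum.Base using (_⊎_; inj₁; inj₂)
open import Function.Base using (_∘_)
open import Function.Bundles using (_↔_; _⇔_; Inverse)
open import Function.Construct.Composition using (_↔-∘_)
open import Function.Construct.Identity using (↔-id)
open import Function.Construct.Symmetry using (↔-sym)
open import Level using (Level; _⊔_) renaming (suc to lsuc)
open import Relation.Binary.Construct.StrictToNonStrict using ()
  renaming (_≤_ to NonStrict)
open import Relation.Binary.Core using (Rel)
open import Relation.Binary.Definitions using (Symmetric)
open import Relation.Binary.PropositionalEquality.Core as ≡ using (_≡_; _≢_)
open import Relation.Binary.Structures using (IsStrictTotalOrder)
open import Relation.Nullary.Negation.Core using (¬_)
open import Relation.Unary using (Pred)

private
  variable
    c ℓ v v′ e e′ : Level

-- The standard library has no real numbers, so ℝ is given by its axioms: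
-- it is the (classically unique up to isomorphism) Dedekind complete
-- ordered field.  Trichotomy makes equality and order decidable, as they
-- are in classical mathematics.

record RealNumbers c ℓ : Set (lsuc (c ⊔ ℓ)) where
  field
    commutativeRing : CommutativeRing c ℓ

  open CommutativeRing commutativeRing public

  infix 4 _<_ _≤_

  field
    _<_                : Rel Carrier ℓ
    isStrictTotalOrder : IsStrictTotalOrder _≈_ _<_
    0≉1                : ¬ (0# ≈ 1#)
    inverse            : ∀ x → ¬ (x ≈ 0#) → ∃ λ y → x * y ≈ 1#
    +-mono-<           : ∀ x y z → x < y → x + z < y + z
    *-pos              : ∀ x y → 0# < x → 0# < y → 0# < x * y

  _≤_ : Rel Carrier ℓ
  _≤_ = NonStrict _≈_ _<_

  UpperBound : ∀ {p} → Pred Carrier p → Pred Carrier (c ⊔ ℓ ⊔ p)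
  UpperBound P b = ∀ x → P x → x ≤ b

  field
    complete : (P : Pred Carrier (c ⊔ ℓ)) → ∃ P → ∃ (UpperBound P) →
               ∃ λ s → UpperBound P s × (∀ b → UpperBound P b → s ≤ b)

data Kind : Set where
  real complex : Kind

module Complex (R : CommutativeRing c ℓ) where
  open CommutativeRing R

  module Additive =
    AbelianGroup (DirectProduct.abelianGroup +-abelianGroup +-abelianGroup)

  open Additive using () renaming (_≈_ to _≋_; _∙_ to _⊕_)

  infixl 7 _·_

  _·_ : Carrier × Carrier → Carrier × Carrier → Carrier × Carrier
  (a , b) · (a′ , b′) = a * a′ - b * b′ , a * b′ + b * a′

  private
    open AbelianGroupProperties +-abelianGroup using (ε⁻¹≈ε)
    open RingProperties ring using (-1*x≈-x)
    open SemiringSolver commutativeSemiring using (solve; _:=_; _:+_; _:*_)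

    ·-cong : ∀ {x y z w} → x ≋ y → z ≋ w → x · z ≋ y · w
    ·-cong (p , q) (p′ , q′) =
      +-cong (*-cong p p′) (-‿cong (*-cong q q′)) ,
      +-cong (*-cong p q′) (*-cong q p′)

    -x≈-1*x : ∀ x → - x ≈ - 1# * x
    -x≈-1*x x = sym (-1*x≈-x x)

    -- With - x replaced by - 1# * x, only commutative semiring identities
    -- remain, in which - 1# is treated as a variable.

    ·-assoc : ∀ x y z → (x · y) · z ≋ x · (y · z)
    ·-assoc (a , b) (a′ , b′) (a″ , b″) =
      trans (+-cong (*-congʳ (+-congˡ (-x≈-1*x _))) (-x≈-1*x _))
        (trans
          (solve 7 (λ n a b a′ b′ a″ b″ →
             (a :* a′ :+ n :* (b :* b′)) :* a″ :+ n :* ((a :* b′ :+ b :* a′) :* b″) :=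
             a :* (a′ :* a″ :+ n :* (b′ :* b″)) :+ n :* (b :* (a′ :* b″ :+ b′ :* a″)))
             refl (- 1#) a b a′ b′ a″ b″)
          (sym (+-cong (*-congˡ (+-congˡ (-x≈-1*x _))) (-x≈-1*x _)))) ,
      trans (+-congʳ (*-congʳ (+-congˡ (-x≈-1*x _))))
        (trans
          (solve 7 (λ n a b a′ b′ a″ b″ →
             (a :* a′ :+ n :* (b :* b′)) :* b″ :+ (a :* b′ :+ b :* a′) :* a″ :=
             a :* (a′ :* b″ :+ b′ :* a″) :+ b :* (a′ :* a″ :+ n :* (b′ :* b″)))
             refl (- 1#) a b a′ b′ a″ b″)
          (sym (+-congˡ (*-congˡ (+-congˡ (-x≈-1*x _))))))

    ·-comm : ∀ x y → x · y ≋ y · x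
    ·-comm (a , b) (a′ , b′) =
      +-cong (*-comm a a′) (-‿cong (*-comm b b′)) ,
      trans (+-comm _ _) (+-cong (*-comm b a′) (*-comm a b′))

    ·-identityˡ : ∀ x → (1# , 0#) · x ≋ x
    ·-identityˡ (a , b) =
      trans (+-cong (*-identityˡ a) (trans (-‿cong (zeroˡ b)) ε⁻¹≈ε)) (+-identityʳ a) ,
      trans (+-cong (*-identityˡ b) (zeroˡ a)) (+-identityʳ b)

    ·-distribˡ : ∀ x y z → x · (y ⊕ z) ≋ (x · y) ⊕ (x · z)
    ·-distribˡ (a , b) (a′ , b′) (a″ , b″) =
      trans (+-congˡ (-x≈-1*x _))
        (trans
          (solve 7 (λ n a b a′ b′ a″ b″ →
             a :* (a′ :+ a″) :+ n :* (b :* (b′ :+ b″)) :=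
             (a :* a′ :+ n :* (b :* b′)) :+ (a :* a″ :+ n :* (b :* b″)))
             refl (- 1#) a b a′ b′ a″ b″)
          (sym (+-cong (+-congˡ (-x≈-1*x _)) (+-congˡ (-x≈-1*x _))))) ,
      solve 6 (λ a b a′ b′ a″ b″ →
        a :* (b′ :+ b″) :+ b :* (a′ :+ a″) :=
        (a :* b′ :+ b :* a′) :+ (a :* b″ :+ b :* a″))
        refl a b a′ b′ a″ b″

    open Consequences Additive.setoid

  complexRing : CommutativeRing c ℓ
  complexRing = record
    { Carrier = Carrier × Carrier
    ; _≈_     = Additive._≈_
    ; _+_     = Additive._∙_
    ; _*_     = _·_
    ; -_      = Additive._⁻¹
    ; 0#      = Additive.ε
    ; 1#      = 1# , 0#
    ; isCommutativeRing = record
      { isRing = record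
        { +-isAbelianGroup = Additive.isAbelianGroup
        ; *-cong          = ·-cong
        ; *-assoc         = ·-assoc
        ; *-identity      = comm∧idˡ⇒id ·-comm ·-identityˡ
        ; distrib         = comm∧distrˡ⇒distr Additive.∙-cong ·-comm ·-distribˡ
        }
      ; *-comm = ·-comm
      }
    }

module _ (ℝ : RealNumbers c ℓ) where
  open RealNumbers ℝ

  scalars : Kind → CommutativeRing c ℓ
  scalars real    = commutativeRing
  scalars complex = Complex.complexRing commutativeRing

  Scalar : Kind → Set c
  Scalar 𝔽 = CommutativeRing.Carrier (scalars 𝔽)

  conj : ∀ 𝔽 → Scalar 𝔽 → Scalar 𝔽
  conj real    a       = a
  conj complex (a , b) = a , - b

  re : ∀ 𝔽 → Scalar 𝔽 → Carrier
  re real    a       = a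
  re complex (a , b) = a

  modulus² : ∀ 𝔽 → Scalar 𝔽 → Carrier
  modulus² real    a       = a * a
  modulus² complex (a , b) = a * a + b * b

record InnerProductSpace (ℝ : RealNumbers c ℓ) (𝔽 : Kind) v e
       : Set (c ⊔ ℓ ⊔ lsuc (v ⊔ e)) where
  private
    module ℝ = RealNumbers ℝ
    module 𝔽 = CommutativeRing (scalars ℝ 𝔽)

  field
    vectorSpace : LeftModule 𝔽.ring v e

  open LeftModule vectorSpace public

  field
    ⟨_,_⟩     : Carrierᴹ → Carrierᴹ → 𝔽.Carrier
    ⟨⟩-cong   : ∀ {x x′ y y′} → x ≈ᴹ x′ → y ≈ᴹ y′ → ⟨ x , y ⟩ 𝔽.≈ ⟨ x′ , y′ ⟩
    ⟨⟩-+      : ∀ x y z → ⟨ x +ᴹ y , z ⟩ 𝔽.≈ ⟨ x , z ⟩ 𝔽.+ ⟨ y , z ⟩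
    ⟨⟩-*      : ∀ a x y → ⟨ a *ₗ x , y ⟩ 𝔽.≈ a 𝔽.* ⟨ x , y ⟩
    ⟨⟩-conj   : ∀ x y → ⟨ x , y ⟩ 𝔽.≈ conj ℝ 𝔽 ⟨ y , x ⟩
    -- ⟨ x , x ⟩ is real by ⟨⟩-conj, so only its real part is constrained.
    ⟨⟩-nonneg : ∀ x → ℝ.0# ℝ.≤ re ℝ 𝔽 ⟨ x , x ⟩
    ⟨⟩-def    : ∀ x → ⟨ x , x ⟩ 𝔽.≈ 𝔽.0# → x ≈ᴹ 0ᴹ

  ‖_‖² : Carrierᴹ → ℝ.Carrier
  ‖ x ‖² = re ℝ 𝔽 ⟨ x , x ⟩

  combination : ∀ {n} → (Fin n → 𝔽.Carrier) → (Fin n → Carrierᴹ) → Carrierᴹ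
  combination a b = Summation.sum +ᴹ-commutativeMonoid (λ i → a i *ₗ b i)

  record IsBasis {n} (b : Fin n → Carrierᴹ) : Set (c ⊔ ℓ ⊔ v ⊔ e) where
    field
      independent : ∀ a → combination a b ≈ᴹ 0ᴹ → ∀ i → a i 𝔽.≈ 𝔽.0#
      spanning    : ∀ x → ∃ λ a → x ≈ᴹ combination a b

  HasDimension : ℕ → Set (c ⊔ ℓ ⊔ v ⊔ e)
  HasDimension d = Σ (Fin d → Carrierᴹ) IsBasis

  IsFrame : ∀ {N} → (Fin N → Carrierᴹ) → Set (c ⊔ ℓ ⊔ v)
  IsFrame f =
    ∃ λ A → ∃ λ B → ℝ.0# ℝ.< A × A ℝ.≤ B ×
      (∀ x → let S = Summation.sum ℝ.+-commutativeMonoid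
                       (λ i → modulus² ℝ 𝔽 ⟨ x , f i ⟩)
             in A ℝ.* ‖ x ‖² ℝ.≤ S × S ℝ.≤ B ℝ.* ‖ x ‖²)

record Graph v e : Set (lsuc (v ⊔ e)) where
  field
    Vertex : Set v
    Adj    : Rel Vertex e
    finite : ∃ λ N → Vertex ↔ Fin N
    sym    : Symmetric Adj
    irrefl : ∀ u → ¬ Adj u u

record _≅_ (G : Graph v e) (H : Graph v′ e′) : Set (v ⊔ e ⊔ v′ ⊔ e′) where
  private
    module G = Graph G
    module H = Graph H
  field
    bijection : G.Vertex ↔ H.Vertex
    adjacency : ∀ u w → G.Adj u w ⇔
                        H.Adj (Inverse.to bijection u) (Inverse.to bijection w)

Path : ℕ → Graph _ _
Path n = record
  { Vertex = Fin n
  ; Adj    = λ i j → toℕ j ≡ suc (toℕ i) ⊎ toℕ i ≡ suc (toℕ j)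
  ; finite = n , ↔-id (Fin n)
  ; sym    = λ where
      (inj₁ p) → inj₂ p
      (inj₂ p) → inj₁ p
  ; irrefl = λ where
      i (inj₁ p) → ℕₚ.1+n≢n (≡.sym p)
      i (inj₂ p) → ℕₚ.1+n≢n (≡.sym p)
  }

infixr 7 _⊠_

_⊠_ : Graph v e → Graph v′ e′ → Graph (v ⊔ v′) (v ⊔ v′ ⊔ e ⊔ e′)
G ⊠ H = record
  { Vertex = G.Vertex × H.Vertex
  ; Adj    = λ (u , w) (u′ , w′) →
      (u ≡ u′ × H.Adj w w′) ⊎ (w ≡ w′ × G.Adj u u′) ⊎ (G.Adj u u′ × H.Adj w w′)
  ; finite = _ , (↔-sym *↔× ↔-∘ (proj₂ G.finite ×-↔ proj₂ H.finite))
  ; sym    = λ where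
      (inj₁ (p , a))        → inj₁ (≡.sym p , H.sym a)
      (inj₂ (inj₁ (p , a))) → inj₂ (inj₁ (≡.sym p , G.sym a))
      (inj₂ (inj₂ (a , b))) → inj₂ (inj₂ (G.sym a , H.sym b))
  ; irrefl = λ where
      (u , w) (inj₁ (_ , a))        → H.irrefl w a
      (u , w) (inj₂ (inj₁ (_ , a))) → G.irrefl u a
      (u , w) (inj₂ (inj₂ (a , _))) → G.irrefl u a
  }
  where
  module G = Graph G
  module H = Graph H

module _ {ℝ : RealNumbers c ℓ} {𝔽 : Kind} (H : InnerProductSpace ℝ 𝔽 v e) where
  open InnerProductSpace H
  private
    module ℝ = RealNumbers ℝ
    module 𝔽 = CommutativeRing (scalars ℝ 𝔽)

    conj-zero : ∀ 𝔽 {z} → let open CommutativeRing (scalars ℝ 𝔽) in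
                z ≈ 0# → conj ℝ 𝔽 z ≈ 0#
    conj-zero real    p       = p
    conj-zero complex (p , q) =
      p , ℝ.trans (ℝ.-‿cong q)
                  (AbelianGroupProperties.ε⁻¹≈ε ℝ.+-abelianGroup)

  -- The vertices are the indices, so that repeated vectors are distinct
  -- vertices.
  frameGraph : ∀ {N} → (Fin N → Carrierᴹ) → Graph _ _
  frameGraph {N} f = record
    { Vertex = Fin N
    ; Adj    = λ i j → i ≢ j × ¬ (⟨ f i , f j ⟩ 𝔽.≈ 𝔽.0#)
    ; finite = N , ↔-id (Fin N)
    ; sym    = λ (i≢j , p) → (i≢j ∘ ≡.sym) ,
        (λ q → p (𝔽.trans (⟨⟩-conj _ _) (conj-zero 𝔽 q)))
    ; irrefl = λ i (i≢i , _) → i≢i ≡.refl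
    }

  IsFrameGraphIn : Graph v′ e′ → Set _
  IsFrameGraphIn G =
    ∃ λ N → Σ (Fin N → Carrierᴹ) λ f → IsFrame f × (frameGraph f ≅ G)

{-# OPTIONS --safe #-}
module Submission where

-- Lower bound: if f realises the graph, then ⟨ f (i+1, j+1) , f (i′, j′) ⟩ ≠ 0
-- forces i ≤ i′ and j ≤ j′, and it is nonzero for (i, j) = (i′, j′).  This
-- (n-1)(m-1)-square matrix is triangular with nonzero diagonal, so its rank
-- (n-1)(m-1) is at most d.  Upper bound: a frame spans, so d ≤ mn.
--
-- Construction: attach to every vertex (p, q) the clique {p, p+1} × {q, q+1},
-- cut off at the border.  The cliques with p < n-1 and q < m-1 already cover
-- every edge.  Choose d cliques including these, a basis e_k of pairwise
-- orthogonal vectors indexed by them, and let f_v be the sum of the e_k whose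
-- clique contains v.  Then ⟨ f_u , f_v ⟩ ≥ 0, with equality exactly when no chosen
-- clique contains both u and v; and the f_v at the corners of the chosen cliques are
-- unitriangular in the e_k, so the f_v span.

open import Defs
open import Algebra.Bundles using (CommutativeMonoid; CommutativeRing)
import Algebra.Properties.CommutativeMonoid.Sum as Sum
import Algebra.Properties.Ring as RingProperties
import Algebra.Properties.Semiring.Sum as SemiringSum
import Algebra.Solver.Ring.NaturalCoefficients.Default as SemiringSolver
open import Data.Fin.Base
  using (Fin; zero; suc; toℕ; fromℕ; punchIn; inject₁; inject≤; combine; remQuot; splitAt; _↑ˡ_)
open import Data.Fin.Permutation using (↔⇒≡)
import Data.Fin.Properties as Finₚ
open import Data.Nat.Base as ℕ using (ℕ; zero; suc; s≤s)
import Data.Nat.Properties as ℕₚ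
open import Data.Nat.Solver using (module +-*-Solver)
open import Data.Product.Base using (∃; _×_; _,_; proj₁; proj₂)
open import Data.Sum.Base as Sum⊎ using (_⊎_; inj₁; inj₂)
import Data.Sum.Properties as Sumₚ
open import Data.Vec.Functional using (insertAt; _∷_)
open import Data.Vec.Functional.Properties using (insertAt-lookup; insertAt-punchIn)
open import Function.Base using (_∘_)
open import Function.Bundles using (_⇔_; Equivalence; Injection; Inverse; mk⇔)
open import Function.Construct.Composition using (_↔-∘_)
open import Function.Construct.Symmetry using (↔-sym)
open import Function.Properties.Inverse using (↔⇒↣)
open import Level using (Level; _⊔_)
open import Relation.Binary.Definitions using (tri<; tri≈; tri>)
import Relation.Binary.Construct.StrictToNonStrict as StrictToNonStrict
open import Relation.Binary.PropositionalEquality as ≡ using (_≡_; _≢_)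
import Relation.Binary.Reasoning.Setoid as SetoidReasoning
open import Relation.Binary.Structures using (IsStrictTotalOrder)
open import Relation.Nullary.Decidable using (Dec; yes; no; ¬?; _×-dec_; _⊎-dec_; map′; decidable-stable)
open import Relation.Nullary.Negation using (¬_; contradiction)

private
  variable
    c ℓ v w : Level
    d k : ℕ

-- Finite sums with at most one nonzero term.

module SumSupport (M : CommutativeMonoid c ℓ) where
  open CommutativeMonoid M
  open Sum M

  sum-zero : (t : Fin k → Carrier) → (∀ i → t i ≈ ε) → sum t ≈ ε
  sum-zero {k} t t≈0 = trans (sum-cong-≋ t≈0) (sum-replicate-zero k)

  sum-single : (t : Fin k → Carrier) (i : Fin k) →
               (∀ j → j ≢ i → t j ≈ ε) → sum t ≈ t i
  sum-single {suc k} t i t≈0 = trans (sum-remove {i = i} t)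
    (trans (∙-congˡ (sum-zero _ (λ j → t≈0 _ (Finₚ.punchInᵢ≢i i j)))) (identityʳ _))

-- Linear algebra over a field with decidable equality to zero.

-- The decidable test `zero?` lets Gaussian elimination search a column for a pivot.
record IsDiscreteField (K : CommutativeRing c ℓ) : Set (c ⊔ ℓ) where
  open CommutativeRing K
  field
    0≉1     : ¬ (0# ≈ 1#)
    zero?   : ∀ x → Dec (x ≈ 0#)
    inverse : ∀ x → ¬ (x ≈ 0#) → ∃ λ y → x * y ≈ 1#

module FieldLinearAlgebra {K : CommutativeRing c ℓ} (isDiscreteField : IsDiscreteField K) where
  open CommutativeRing K hiding (zero)
  open IsDiscreteField isDiscreteField
  open SemiringSum semiring
  open SumSupport +-commutativeMonoid
  open RingProperties ring using (-‿distribˡ-*)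
  open SetoidReasoning setoid

  cancel-nonzero : ∀ {x y} → ¬ (y ≈ 0#) → x * y ≈ 0# → x ≈ 0#
  cancel-nonzero {x} {y} y≉0 xy≈0 with y⁻¹ , yy⁻¹≈1 ← inverse y y≉0 = begin
    x              ≈⟨ *-identityʳ x ⟨
    x * 1#         ≈⟨ *-congˡ yy⁻¹≈1 ⟨
    x * (y * y⁻¹)  ≈⟨ *-assoc x y y⁻¹ ⟨
    x * y * y⁻¹    ≈⟨ *-congʳ xy≈0 ⟩
    0# * y⁻¹       ≈⟨ zeroˡ y⁻¹ ⟩
    0#             ∎

  -- Gaussian elimination on the first column, by induction on the number of columns.
  nontrivial-kernel : d ℕ.< k → (M : Fin k → Fin d → Carrier) →
    ∃ λ (a : Fin k → Carrier) → (∃ λ q → ¬ (a q ≈ 0#)) × (∀ p → sum (λ q → a q * M q p) ≈ 0#)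
  nontrivial-kernel {zero} {suc k} _ M = (λ _ → 1#) , (zero , 0≉1 ∘ sym) , λ ()
  nontrivial-kernel {suc d} {suc k} (s≤s d<k) M
    with Finₚ.any? (λ q → ¬? (zero? (M q zero)))
  -- The first column vanishes, so a relation for the other columns is one for all of `M`.
  ... | no none with a , a≉0 , rel ← nontrivial-kernel (ℕₚ.m≤n⇒m≤1+n d<k) (λ q → M q ∘ suc)
    = a , a≉0 , λ where
        zero    → sum-zero {k = suc k} _ λ q → trans
          (*-congˡ (decidable-stable (zero? (M q zero)) λ ≉0 → none (q , ≉0)))
          (zeroʳ (a q))
        (suc p) → rel p
  -- Row `i` is the pivot. A multiple of it is added to each other row to clear the first column,
  -- which leaves one row and one column fewer.
  ... | yes (i , Mᵢ≉0)
    with y , My≈1 ← inverse (M i zero) Mᵢ≉0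
    with a , (q , a≉0) , rel ← nontrivial-kernel d<k
           (λ q p → M (punchIn i q) (suc p) + M (punchIn i q) zero * (- y * M i (suc p)))
    = a′ , (punchIn i q , a≉0 ∘ trans (reflexive (≡.sym (insertAt-punchIn a i _ q)))) , rel′
    where
    s = sum (λ q → a q * M (punchIn i q) zero)
    -- The pivot row gets the coefficient that cancels the contribution `s` of the other rows to the
    -- first column; in the other columns it restores the row operations.
    a′ = insertAt a i (s * - y)

    split : ∀ p → sum (λ q → a′ q * M q p) ≈
                  s * - y * M i p + sum (λ q → a q * M (punchIn i q) p)
    split p = trans (sum-remove {i = i} (λ q → a′ q * M q p))
      (+-cong (*-congʳ (reflexive (insertAt-lookup a i _)))
              (sum-cong-≋ {k} λ q → *-congʳ (reflexive (insertAt-punchIn a i _ q))))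

    -yM+1≈0 : - y * M i zero + 1# ≈ 0#
    -yM+1≈0 = trans
      (+-congʳ (trans (sym (-‿distribˡ-* y _)) (-‿cong (trans (*-comm y _) My≈1))))
      (-‿inverseˡ 1#)

    rel′ : ∀ p → sum (λ q → a′ q * M q p) ≈ 0#
    rel′ zero = begin
      _                              ≈⟨ split zero ⟩
      s * - y * M i zero + s         ≈⟨ +-cong (*-assoc s _ _) (sym (*-identityʳ s)) ⟩
      s * (- y * M i zero) + s * 1#  ≈⟨ distribˡ s _ _ ⟨
      s * (- y * M i zero + 1#)      ≈⟨ *-congˡ -yM+1≈0 ⟩
      s * 0#                         ≈⟨ zeroʳ s ⟩
      0#                             ∎
    rel′ (suc p) = begin
      _
        ≈⟨ split (suc p) ⟩
      s * - y * M i (suc p) + sum (λ q → a q * M (punchIn i q) (suc p))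
        ≈⟨ trans (+-congʳ (*-assoc s _ _)) (+-comm _ _) ⟩
      sum (λ q → a q * M (punchIn i q) (suc p)) + s * z
        ≈⟨ +-congˡ (*-distribʳ-sum {k} z _) ⟩
      sum (λ q → a q * M (punchIn i q) (suc p)) + sum (λ q → a q * M (punchIn i q) zero * z)
        ≈⟨ ∑-distrib-+ {k} _ _ ⟨
      sum (λ q → a q * M (punchIn i q) (suc p) + a q * M (punchIn i q) zero * z)
        ≈⟨ sum-cong-≋ {k} (λ q → trans (+-congˡ (*-assoc _ _ _)) (sym (distribˡ (a q) _ _))) ⟩
      sum (λ q → a q * (M (punchIn i q) (suc p) + M (punchIn i q) zero * z))
        ≈⟨ rel p ⟩
      0# ∎
      where z = - y * M i (suc p)

  -- Forward substitution in order of increasing level: in column `p` all rows of lower level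
  -- already have coefficient zero, so only the diagonal term is left.
  triangular-kernel : (level : Fin k → ℕ) (M : Fin k → Fin k → Carrier) (a : Fin k → Carrier) →
    (∀ p → ¬ (M p p ≈ 0#)) →
    (∀ q p → ¬ (M q p ≈ 0#) → q ≡ p ⊎ level q ℕ.< level p) →
    (∀ p → sum (λ q → a q * M q p) ≈ 0#) → ∀ p → a p ≈ 0#
  triangular-kernel {k} level M a diagonal triangular rel p = below (suc (level p)) p ℕₚ.≤-refl
    where
    -- The bound `l` turns strong induction on the level into structural recursion.
    below : ∀ l p → level p ℕ.< l → a p ≈ 0#
    below (suc l) p (s≤s p≤l) = cancel-nonzero (diagonal p)
      (trans (sym (sum-single {k = k} _ p vanish)) (rel p))
      where
      vanish : ∀ q → q ≢ p → a q * M q p ≈ 0#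
      vanish q q≢p with zero? (M q p)
      ... | yes M≈0 = trans (*-congˡ M≈0) (zeroʳ _)
      ... | no M≉0 with triangular q p M≉0
      ...   | inj₁ q≡p = contradiction q≡p q≢p
      ...   | inj₂ q<p = trans (*-congʳ (below l q (ℕₚ.<-≤-trans q<p p≤l))) (zeroˡ _)

  sum-assoc : (a : Fin k → Carrier) (M : Fin k → Fin d → Carrier) (b : Fin d → Carrier) →
    sum (λ q → a q * sum (λ p → M q p * b p)) ≈ sum (λ p → sum (λ q → a q * M q p) * b p)
  sum-assoc {k} {d} a M b = begin
    sum (λ q → a q * sum (λ p → M q p * b p))    ≈⟨ sum-cong-≋ {k} (λ q → *-distribˡ-sum {d} (a q) _) ⟩
    sum (λ q → sum (λ p → a q * (M q p * b p)))  ≈⟨ ∑-comm {k} {d} _ ⟩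
    sum (λ p → sum (λ q → a q * (M q p * b p)))  ≈⟨ sum-cong-≋ {d} (λ p → sum-cong-≋ {k} λ q → sym (*-assoc _ _ _)) ⟩
    sum (λ p → sum (λ q → a q * M q p * b p))    ≈⟨ sum-cong-≋ {d} (λ p → sym (*-distribʳ-sum {k} (b p) _)) ⟩
    sum (λ p → sum (λ q → a q * M q p) * b p)    ∎

-- Order and arithmetic of the real numbers.

module OrderedField (ℝ : RealNumbers c ℓ) where
  open RealNumbers ℝ
    using (commutativeRing; _<_; _≤_; isStrictTotalOrder; 0≉1; inverse; +-mono-<; *-pos)
  open CommutativeRing commutativeRing hiding (zero)
  open IsStrictTotalOrder isStrictTotalOrder public
    using (compare; _≟_) renaming (irrefl to <-irrefl; trans to <-trans; <-resp-≈ to <-resp)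
  open RingProperties ring using (-‿distribˡ-*; -‿distribʳ-*; -‿involutive)
  open SemiringSolver commutativeSemiring using (solve; _:=_; _:+_; _:*_)
  open Sum +-commutativeMonoid using (sum)

  private
    module NS = StrictToNonStrict _≈_ _<_

  ≤-trans : ∀ {x y z} → x ≤ y → y ≤ z → x ≤ z
  ≤-trans = NS.trans isEquivalence <-resp <-trans

  ≤-reflexive : ∀ {x y} → x ≈ y → x ≤ y
  ≤-reflexive = inj₂

  ≤-refl : ∀ {x} → x ≤ x
  ≤-refl = inj₂ refl

  ≤-antisym : ∀ {x y} → x ≤ y → y ≤ x → x ≈ y
  ≤-antisym = NS.antisym isEquivalence <-trans <-irrefl

  <-≤-trans : ∀ {x y z} → x < y → y ≤ z → x < z
  <-≤-trans = NS.<-≤-trans <-trans (proj₁ <-resp)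

  ≤-<-trans : ∀ {x y z} → x ≤ y → y < z → x < z
  ≤-<-trans = NS.≤-<-trans sym <-trans (proj₂ <-resp)

  ≤-resp-≈ : ∀ {x x′ y y′} → x ≈ x′ → y ≈ y′ → x ≤ y → x′ ≤ y′
  ≤-resp-≈ x≈x′ y≈y′ x≤y = ≤-trans (inj₂ (sym x≈x′)) (≤-trans x≤y (inj₂ y≈y′))

  +-monoˡ-≤ : ∀ {x y} z → x ≤ y → x + z ≤ y + z
  +-monoˡ-≤ z (inj₁ x<y) = inj₁ (+-mono-< _ _ z x<y)
  +-monoˡ-≤ z (inj₂ x≈y) = inj₂ (+-congʳ x≈y)

  +-mono-≤ : ∀ {x y z w} → x ≤ y → z ≤ w → x + z ≤ y + w
  +-mono-≤ {x} {y} {z} {w} x≤y z≤w = ≤-trans (+-monoˡ-≤ z x≤y)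
    (≤-trans (inj₂ (+-comm y z)) (≤-trans (+-monoˡ-≤ y z≤w) (inj₂ (+-comm w y))))

  x≤x+y : ∀ {x y} → 0# ≤ y → x ≤ x + y
  x≤x+y 0≤y = ≤-trans (inj₂ (sym (+-identityʳ _))) (+-mono-≤ ≤-refl 0≤y)

  +-nonneg : ∀ {x y} → 0# ≤ x → 0# ≤ y → 0# ≤ x + y
  +-nonneg 0≤x 0≤y = ≤-trans 0≤x (x≤x+y 0≤y)

  *-nonneg : ∀ {x y} → 0# ≤ x → 0# ≤ y → 0# ≤ x * y
  *-nonneg (inj₁ 0<x) (inj₁ 0<y) = inj₁ (*-pos _ _ 0<x 0<y)
  *-nonneg (inj₂ 0≈x) _          = inj₂ (trans (sym (zeroˡ _)) (*-congʳ 0≈x))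
  *-nonneg (inj₁ _)   (inj₂ 0≈y) = inj₂ (trans (sym (zeroʳ _)) (*-congˡ 0≈y))

  *-monoˡ-≤ : ∀ {x y z} → 0# ≤ x → y ≤ z → x * y ≤ x * z
  *-monoˡ-≤ {x} {y} {z} 0≤x y≤z = ≤-trans (x≤x+y (*-nonneg 0≤x 0≤z-y)) (inj₂ step)
    where
    0≤z-y : 0# ≤ z - y
    0≤z-y = ≤-trans (inj₂ (sym (-‿inverseʳ y))) (+-monoˡ-≤ (- y) y≤z)
    step : x * y + x * (z - y) ≈ x * z
    step = trans (sym (distribˡ x y _)) (*-congˡ
      (trans (+-comm y _) (trans (+-assoc z _ y) (trans (+-congˡ (-‿inverseˡ y)) (+-identityʳ z)))))

  *-monoʳ-≤ : ∀ {x y z} → 0# ≤ x → y ≤ z → y * x ≤ z * x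
  *-monoʳ-≤ {x} {y} {z} 0≤x y≤z = ≤-resp-≈ (*-comm x y) (*-comm x z) (*-monoˡ-≤ 0≤x y≤z)

  x<0⇒0<-x : ∀ {x} → x < 0# → 0# < - x
  x<0⇒0<-x {x} x<0 = ≤-<-trans (inj₂ (sym (-‿inverseʳ x)))
    (<-≤-trans (+-mono-< _ _ (- x) x<0) (inj₂ (+-identityˡ _)))

  square-nonneg : ∀ x → 0# ≤ x * x
  square-nonneg x with compare x 0#
  ... | tri> _ _ 0<x = inj₁ (*-pos x x 0<x 0<x)
  ... | tri≈ _ x≈0 _ = inj₂ (trans (sym (zeroˡ x)) (*-congʳ (sym x≈0)))
  ... | tri< x<0 _ _ = ≤-trans (inj₁ (*-pos _ _ (x<0⇒0<-x x<0) (x<0⇒0<-x x<0))) (inj₂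
    (trans (sym (-‿distribˡ-* x _)) (trans (-‿cong (sym (-‿distribʳ-* x x))) (-‿involutive _))))

  0<1 : 0# < 1#
  0<1 with ≤-trans (square-nonneg 1#) (inj₂ (*-identityˡ 1#))
  ... | inj₁ 0<1 = 0<1
  ... | inj₂ 0≈1 = contradiction 0≈1 0≉1

  nonneg∧≉0⇒pos : ∀ {x} → 0# ≤ x → ¬ (x ≈ 0#) → 0# < x
  nonneg∧≉0⇒pos (inj₁ 0<x) _   = 0<x
  nonneg∧≉0⇒pos (inj₂ 0≈x) x≉0 = contradiction (sym 0≈x) x≉0

  pos⇒≉0 : ∀ {x} → 0# < x → ¬ (x ≈ 0#)
  pos⇒≉0 0<x x≈0 = <-irrefl (sym x≈0) 0<x

  -- The inverse is not zero since `0# ≉ 1#`, and it is not negative since `x * - y ≈ - 1#` would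
  -- then be positive.
  positive-inverse : ∀ {x} → 0# < x → ∃ λ y → 0# < y × x * y ≈ 1#
  positive-inverse {x} 0<x = y , 0<y (compare y 0#) , xy≈1
    where
    y = proj₁ (inverse x (pos⇒≉0 0<x))
    xy≈1 = proj₂ (inverse x (pos⇒≉0 0<x))

    x*-y≈-1 : x * - y ≈ - 1#
    x*-y≈-1 = trans (sym (-‿distribʳ-* x y)) (-‿cong xy≈1)

    0≮-1 : ¬ (0# < - 1#)
    0≮-1 0<-1 = <-irrefl refl (<-trans 0<1
      (≤-<-trans (inj₂ (sym (+-identityˡ 1#)))
        (<-≤-trans (+-mono-< _ _ 1# 0<-1) (inj₂ (-‿inverseˡ 1#)))))

    0<y : _ → 0# < y
    0<y (tri> _ _ 0<y) = 0<y
    0<y (tri≈ _ y≈0 _) =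
      contradiction (trans (sym (zeroʳ x)) (trans (*-congˡ (sym y≈0)) xy≈1)) 0≉1
    0<y (tri< y<0 _ _) = contradiction
      (<-≤-trans (*-pos x (- y) 0<x (x<0⇒0<-x y<0)) (inj₂ x*-y≈-1)) 0≮-1

  sum-nonneg : (t : Fin k → Carrier) → (∀ i → 0# ≤ t i) → 0# ≤ sum t
  sum-nonneg {zero}  t 0≤t = ≤-refl
  sum-nonneg {suc k} t 0≤t = +-nonneg (0≤t zero) (sum-nonneg (t ∘ suc) (0≤t ∘ suc))

  sum-mono-≤ : (s t : Fin k → Carrier) → (∀ i → s i ≤ t i) → sum s ≤ sum t
  sum-mono-≤ {zero}  s t s≤t = ≤-refl
  sum-mono-≤ {suc k} s t s≤t = +-mono-≤ (s≤t zero) (sum-mono-≤ (s ∘ suc) (t ∘ suc) (s≤t ∘ suc))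

  term≤sum : (t : Fin k → Carrier) → (∀ i → 0# ≤ t i) → ∀ i → t i ≤ sum t
  term≤sum {suc k} t 0≤t zero    = x≤x+y (sum-nonneg (t ∘ suc) (0≤t ∘ suc))
  term≤sum {suc k} t 0≤t (suc i) = ≤-trans (term≤sum (t ∘ suc) (0≤t ∘ suc) i)
    (≤-trans (x≤x+y (0≤t zero)) (inj₂ (+-comm _ _)))

  +-nonneg-zeroˡ : ∀ {x y} → 0# ≤ x → 0# ≤ y → x + y ≈ 0# → x ≈ 0#
  +-nonneg-zeroˡ 0≤x 0≤y x+y≈0 = ≤-antisym (≤-trans (x≤x+y 0≤y) (inj₂ x+y≈0)) 0≤x

  square≈0⇒≈0 : ∀ {x} → x * x ≈ 0# → x ≈ 0#
  square≈0⇒≈0 {x} xx≈0 = decidable-stable (x ≟ 0#) λ x≉0 →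
    let y , xy≈1 = inverse x x≉0 in
    x≉0 (trans (sym (*-identityʳ x)) (trans (*-congˡ (sym xy≈1))
      (trans (sym (*-assoc x x y)) (trans (*-congʳ xx≈0) (zeroˡ y)))))

  -- Allows a constant of unknown sign to be replaced by a positive one.
  x≤x²+1 : ∀ x → x ≤ x * x + 1#
  x≤x²+1 x with compare x 1#
  ... | tri< x<1 _ _ = ≤-trans (inj₁ x<1)
                         (≤-trans (x≤x+y (square-nonneg x)) (inj₂ (+-comm _ _)))
  ... | tri≈ _ x≈1 _ = ≤-trans (inj₂ x≈1)
                         (≤-trans (x≤x+y (square-nonneg x)) (inj₂ (+-comm _ _)))
  ... | tri> _ _ 1<x = ≤-trans
    (≤-resp-≈ (*-identityʳ x) refl (*-monoˡ-≤ (inj₁ (<-trans 0<1 1<x)) (inj₁ 1<x)))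
    (x≤x+y (inj₁ 0<1))

  -- With y = x + t, the two sides differ by t².
  square-+-≤ : ∀ x y → (x + y) * (x + y) ≤ x * x + y * y + (x * x + y * y)
  square-+-≤ x y = ≤-trans (x≤x+y (square-nonneg t)) (inj₂ (trans
    (+-congʳ (*-cong (+-congˡ y≈x+t) (+-congˡ y≈x+t)))
    (trans (solve 2 (λ x t →
       (x :+ (x :+ t)) :* (x :+ (x :+ t)) :+ t :* t :=
       x :* x :+ (x :+ t) :* (x :+ t) :+ (x :* x :+ (x :+ t) :* (x :+ t))) refl x t)
      (+-cong (+-congˡ (sym yy≈)) (+-congˡ (sym yy≈))))))
    where
    t = y - x
    y≈x+t : y ≈ x + t
    y≈x+t = trans (sym (+-identityʳ y)) (trans (+-congˡ (sym (-‿inverseˡ x)))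
      (trans (sym (+-assoc y _ x)) (+-comm _ x)))
    yy≈ : y * y ≈ (x + t) * (x + t)
    yy≈ = *-cong y≈x+t y≈x+t

-- Real and complex scalars treated uniformly.

module Scalars (ℝ : RealNumbers c ℓ) where
  open RealNumbers ℝ using (commutativeRing; _≤_; 0≉1; inverse; +-mono-<)
  open CommutativeRing commutativeRing hiding (zero)
  open OrderedField ℝ
  open RingProperties ring using (-0#≈0#; -‿distribʳ-*; -‿involutive; -‿+-comm)
  open SemiringSolver commutativeSemiring using (solve; _:=_; _:+_; _:*_)

  private
    module S (𝔽 : Kind) = CommutativeRing (scalars ℝ 𝔽)

  ∣_∋_∣² : ∀ 𝔽 → Scalar ℝ 𝔽 → Carrier
  ∣_∋_∣² = modulus² ℝ

  -- The embedding of the reals. The frame vectors constructed below have coefficients in its image,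
  -- which conjugation fixes.
  ι : ∀ 𝔽 → Carrier → Scalar ℝ 𝔽
  ι real    t = t
  ι complex t = t , 0#

  ι-cong : ∀ 𝔽 {s t} → s ≈ t → S._≈_ 𝔽 (ι 𝔽 s) (ι 𝔽 t)
  ι-cong real    s≈t = s≈t
  ι-cong complex s≈t = s≈t , refl

  ι-0 : ∀ 𝔽 → S._≈_ 𝔽 (ι 𝔽 0#) (S.0# 𝔽)
  ι-0 real    = refl
  ι-0 complex = refl , refl

  ι-1 : ∀ 𝔽 → S._≈_ 𝔽 (ι 𝔽 1#) (S.1# 𝔽)
  ι-1 real    = refl
  ι-1 complex = refl , refl

  ι-+ : ∀ 𝔽 s t → S._≈_ 𝔽 (ι 𝔽 (s + t)) (S._+_ 𝔽 (ι 𝔽 s) (ι 𝔽 t))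
  ι-+ real    s t = refl
  ι-+ complex s t = refl , sym (+-identityʳ 0#)

  private
    scale : ∀ t a b → S._≈_ complex (S._*_ complex (t , 0#) (a , b)) (t * a , t * b)
    scale t a b =
      trans (+-congˡ (trans (-‿cong (zeroˡ b)) -0#≈0#)) (+-identityʳ _) ,
      trans (+-congˡ (zeroˡ a)) (+-identityʳ _)

    square-* : ∀ s t → s * t * (s * t) ≈ s * s * (t * t)
    square-* = solve 2 (λ s t → s :* t :* (s :* t) := s :* s :* (t :* t)) refl

  ι-* : ∀ 𝔽 s t → S._≈_ 𝔽 (ι 𝔽 (s * t)) (S._*_ 𝔽 (ι 𝔽 s) (ι 𝔽 t))
  ι-* real    s t = refl
  ι-* complex s t = S.sym complex
    {S._*_ complex (s , 0#) (t , 0#)} {s * t , 0#}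
    (proj₁ (scale s t 0#) , trans (proj₂ (scale s t 0#)) (zeroʳ s))

  ι≈0⇒≈0 : ∀ 𝔽 {t} → S._≈_ 𝔽 (ι 𝔽 t) (S.0# 𝔽) → t ≈ 0#
  ι≈0⇒≈0 real    t≈0       = t≈0
  ι≈0⇒≈0 complex (t≈0 , _) = t≈0

  conj-cong : ∀ 𝔽 {z w} → S._≈_ 𝔽 z w → S._≈_ 𝔽 (conj ℝ 𝔽 z) (conj ℝ 𝔽 w)
  conj-cong real    p       = p
  conj-cong complex (p , q) = p , -‿cong q

  conj-ι : ∀ 𝔽 t → S._≈_ 𝔽 (conj ℝ 𝔽 (ι 𝔽 t)) (ι 𝔽 t)
  conj-ι real    t = refl
  conj-ι complex t = refl , -0#≈0#

  conj-0 : ∀ 𝔽 → S._≈_ 𝔽 (conj ℝ 𝔽 (S.0# 𝔽)) (S.0# 𝔽)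
  conj-0 real    = refl
  conj-0 complex = refl , -0#≈0#

  conj-+ : ∀ 𝔽 z w → S._≈_ 𝔽 (conj ℝ 𝔽 (S._+_ 𝔽 z w))
                              (S._+_ 𝔽 (conj ℝ 𝔽 z) (conj ℝ 𝔽 w))
  conj-+ real    z w = refl
  conj-+ complex (a , b) (a′ , b′) = refl , sym (-‿+-comm b b′)

  conj-ι* : ∀ 𝔽 t z → S._≈_ 𝔽 (conj ℝ 𝔽 (S._*_ 𝔽 (ι 𝔽 t) z)) (S._*_ 𝔽 (ι 𝔽 t) (conj ℝ 𝔽 z))
  conj-ι* real    t z = refl
  conj-ι* complex t (a , b) = S.trans complex
    {conj ℝ complex (S._*_ complex (t , 0#) (a , b))} {t * a , t * - b}
    (proj₁ (scale t a b) , trans (-‿cong (proj₂ (scale t a b))) (-‿distribʳ-* t b))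
    (S.sym complex {S._*_ complex (t , 0#) (a , - b)} (scale t a (- b)))

  z*conj-z : ∀ 𝔽 z → S._≈_ 𝔽 (S._*_ 𝔽 z (conj ℝ 𝔽 z)) (ι 𝔽 ∣ 𝔽 ∋ z ∣²)
  z*conj-z real    z = refl
  z*conj-z complex (a , b) =
    +-congˡ (trans (-‿cong (sym (-‿distribʳ-* b b))) (-‿involutive _)) ,
    trans (+-cong (sym (-‿distribʳ-* a b)) (*-comm b a)) (-‿inverseˡ _)

  re-cong : ∀ 𝔽 {z w} → S._≈_ 𝔽 z w → re ℝ 𝔽 z ≈ re ℝ 𝔽 w
  re-cong real    p       = p
  re-cong complex (p , _) = p

  re-ι : ∀ 𝔽 t → re ℝ 𝔽 (ι 𝔽 t) ≈ t
  re-ι real    t = refl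
  re-ι complex t = refl

  -- The imaginary part equals its own negative, so its double is zero, which trichotomy excludes
  -- for a positive or a negative number.
  self-conjugate⇒real : ∀ 𝔽 {z} → S._≈_ 𝔽 z (conj ℝ 𝔽 z) → S._≈_ 𝔽 z (ι 𝔽 (re ℝ 𝔽 z))
  self-conjugate⇒real real    _       = refl
  self-conjugate⇒real complex {a , b} (_ , b≈-b) = refl , b≈0
    where
    b+b≈0 : b + b ≈ 0#
    b+b≈0 = trans (+-congˡ b≈-b) (-‿inverseʳ b)
    b≈0 : b ≈ 0#
    b≈0 with compare b 0#
    ... | tri≈ _ p _ = p
    ... | tri> _ _ 0<b = contradiction (sym b+b≈0)
      (λ p → <-irrefl p (<-trans 0<b (≤-<-trans (≤-reflexive (sym (+-identityˡ b))) (+-mono-< _ _ b 0<b))))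
    ... | tri< b<0 _ _ = contradiction b+b≈0
      (λ p → <-irrefl p (<-≤-trans (+-mono-< _ _ b b<0) (≤-trans (≤-reflexive (+-identityˡ b)) (inj₁ b<0))))

  ∣∣²-cong : ∀ 𝔽 {z w} → S._≈_ 𝔽 z w → ∣ 𝔽 ∋ z ∣² ≈ ∣ 𝔽 ∋ w ∣²
  ∣∣²-cong real    p       = *-cong p p
  ∣∣²-cong complex (p , q) = +-cong (*-cong p p) (*-cong q q)

  ∣∣²-nonneg : ∀ 𝔽 z → 0# ≤ ∣ 𝔽 ∋ z ∣²
  ∣∣²-nonneg real    z       = square-nonneg z
  ∣∣²-nonneg complex (a , b) = +-nonneg (square-nonneg a) (square-nonneg b)

  ∣0∣² : ∀ 𝔽 → ∣ 𝔽 ∋ S.0# 𝔽 ∣² ≈ 0#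
  ∣0∣² real    = zeroˡ 0#
  ∣0∣² complex = trans (+-cong (zeroˡ 0#) (zeroˡ 0#)) (+-identityʳ 0#)

  ∣∣²≈0⇒≈0 : ∀ 𝔽 z → ∣ 𝔽 ∋ z ∣² ≈ 0# → S._≈_ 𝔽 z (S.0# 𝔽)
  ∣∣²≈0⇒≈0 real    z       p = square≈0⇒≈0 p
  ∣∣²≈0⇒≈0 complex (a , b) p =
    square≈0⇒≈0 (+-nonneg-zeroˡ (square-nonneg a) (square-nonneg b) p) ,
    square≈0⇒≈0 (+-nonneg-zeroˡ (square-nonneg b) (square-nonneg a) (trans (+-comm _ _) p))

  -- A triangle inequality free of square roots: the squared modulus of a sum is at most twice the
  -- sum of the squared moduli. The complex case applies the real one to each coordinate.
  ∣+∣²-≤ : ∀ 𝔽 z w → ∣ 𝔽 ∋ S._+_ 𝔽 z w ∣² ≤ ∣ 𝔽 ∋ z ∣² + ∣ 𝔽 ∋ w ∣² + (∣ 𝔽 ∋ z ∣² + ∣ 𝔽 ∋ w ∣²)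
  ∣+∣²-≤ real    z w = square-+-≤ z w
  ∣+∣²-≤ complex (a , b) (a′ , b′) =
    ≤-trans (+-mono-≤ (square-+-≤ a a′) (square-+-≤ b b′)) (≤-reflexive
      (solve 4 (λ x x′ y y′ →
         x :+ x′ :+ (x :+ x′) :+ (y :+ y′ :+ (y :+ y′)) :=
         x :+ y :+ (x′ :+ y′) :+ (x :+ y :+ (x′ :+ y′)))
       refl (a * a) (a′ * a′) (b * b) (b′ * b′)))

  ∣ι*∣² : ∀ 𝔽 t z → ∣ 𝔽 ∋ S._*_ 𝔽 (ι 𝔽 t) z ∣² ≈ t * t * ∣ 𝔽 ∋ z ∣²
  ∣ι*∣² real    t z = square-* t z
  ∣ι*∣² complex t (a , b) = trans
    (∣∣²-cong complex {S._*_ complex (t , 0#) (a , b)} (scale t a b))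
    (trans (+-cong (square-* t a) (square-* t b)) (sym (distribˡ _ _ _)))

  zero? : ∀ 𝔽 z → Dec (S._≈_ 𝔽 z (S.0# 𝔽))
  zero? 𝔽 z = map′ (∣∣²≈0⇒≈0 𝔽 z) (λ p → trans (∣∣²-cong 𝔽 p) (∣0∣² 𝔽)) (∣ 𝔽 ∋ z ∣² ≟ 0#)

  -- The inverse of z is z̄ / |z|².
  scalar-inverse : ∀ 𝔽 z → ¬ (S._≈_ 𝔽 z (S.0# 𝔽)) →
                   ∃ λ w → S._≈_ 𝔽 (S._*_ 𝔽 z w) (S.1# 𝔽)
  scalar-inverse 𝔽 z z≉0 with t , p ← inverse ∣ 𝔽 ∋ z ∣² (z≉0 ∘ ∣∣²≈0⇒≈0 𝔽 z) =
    conj ℝ 𝔽 z K.* ι 𝔽 t , (begin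
      z K.* (conj ℝ 𝔽 z K.* ι 𝔽 t) ≈⟨ K.*-assoc z _ _ ⟨
      z K.* conj ℝ 𝔽 z K.* ι 𝔽 t   ≈⟨ K.*-congʳ (z*conj-z 𝔽 z) ⟩
      ι 𝔽 ∣ 𝔽 ∋ z ∣² K.* ι 𝔽 t     ≈⟨ ι-* 𝔽 _ _ ⟨
      ι 𝔽 (∣ 𝔽 ∋ z ∣² * t)         ≈⟨ ι-cong 𝔽 p ⟩
      ι 𝔽 1#                   ≈⟨ ι-1 𝔽 ⟩
      K.1#                         ∎)
    where
    module K = S 𝔽
    open SetoidReasoning K.setoid

  scalar-0≉1 : ∀ 𝔽 → ¬ (S._≈_ 𝔽 (S.0# 𝔽) (S.1# 𝔽))
  scalar-0≉1 real    0≈1       = 0≉1 0≈1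
  scalar-0≉1 complex (0≈1 , _) = 0≉1 0≈1

  scalars-isDiscreteField : ∀ 𝔽 → IsDiscreteField (scalars ℝ 𝔽)
  scalars-isDiscreteField 𝔽 = record
    { 0≉1 = scalar-0≉1 𝔽 ; zero? = zero? 𝔽 ; inverse = scalar-inverse 𝔽 }

-- Dimension counts and orthogonal bases in inner product spaces.

module InnerProducts {ℝ : RealNumbers c ℓ} {𝔽 : Kind} (H : InnerProductSpace ℝ 𝔽 v w) where
  open InnerProductSpace H
  open OrderedField ℝ
  open Scalars ℝ
  open RealNumbers ℝ using (_<_)

  private
    module ℝ = CommutativeRing (RealNumbers.commutativeRing ℝ)
    module K = CommutativeRing (scalars ℝ 𝔽)
    module Σℝ = SemiringSum ℝ.semiring
    module ΣK = SemiringSum K.semiring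
    module Supportᴷ = SumSupport K.+-commutativeMonoid

  open FieldLinearAlgebra (scalars-isDiscreteField 𝔽)
  open RingProperties K.ring using (-1*x≈-x; x∙y⁻¹≈ε⇒x≈y)

  ⟨0,_⟩ : ∀ y → ⟨ 0ᴹ , y ⟩ K.≈ K.0#
  ⟨0, y ⟩ = K.trans (⟨⟩-cong (≈ᴹ-sym (*ₗ-zeroˡ 0ᴹ)) ≈ᴹ-refl) (K.trans (⟨⟩-* _ _ _) (K.zeroˡ _))

  ⟨⟩-combination : ∀ (a : Fin k → K.Carrier) b y →
    ⟨ combination a b , y ⟩ K.≈ ΣK.sum (λ i → a i K.* ⟨ b i , y ⟩)
  ⟨⟩-combination {zero}  a b y = ⟨0, y ⟩
  ⟨⟩-combination {suc k} a b y = K.trans (⟨⟩-+ _ _ y)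
    (K.+-cong (⟨⟩-* _ _ y) (⟨⟩-combination (a ∘ suc) (b ∘ suc) y))

  ⟨⟩-+ʳ : ∀ x y z → ⟨ x , y +ᴹ z ⟩ K.≈ ⟨ x , y ⟩ K.+ ⟨ x , z ⟩
  ⟨⟩-+ʳ x y z = begin
    ⟨ x , y +ᴹ z ⟩                              ≈⟨ ⟨⟩-conj _ _ ⟩
    conj ℝ 𝔽 ⟨ y +ᴹ z , x ⟩                     ≈⟨ conj-cong 𝔽 (⟨⟩-+ y z x) ⟩
    conj ℝ 𝔽 (⟨ y , x ⟩ K.+ ⟨ z , x ⟩)          ≈⟨ conj-+ 𝔽 _ _ ⟩
    conj ℝ 𝔽 ⟨ y , x ⟩ K.+ conj ℝ 𝔽 ⟨ z , x ⟩   ≈⟨ K.+-cong (⟨⟩-conj x y) (⟨⟩-conj x z) ⟨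
    ⟨ x , y ⟩ K.+ ⟨ x , z ⟩                     ∎
    where open SetoidReasoning K.setoid

  ⟨⟩-ι*ʳ : ∀ t x y → ⟨ x , ι 𝔽 t *ₗ y ⟩ K.≈ ι 𝔽 t K.* ⟨ x , y ⟩
  ⟨⟩-ι*ʳ t x y = begin
    ⟨ x , ι 𝔽 t *ₗ y ⟩               ≈⟨ ⟨⟩-conj _ _ ⟩
    conj ℝ 𝔽 ⟨ ι 𝔽 t *ₗ y , x ⟩      ≈⟨ conj-cong 𝔽 (⟨⟩-* _ y x) ⟩
    conj ℝ 𝔽 (ι 𝔽 t K.* ⟨ y , x ⟩)   ≈⟨ conj-ι* 𝔽 t _ ⟩
    ι 𝔽 t K.* conj ℝ 𝔽 ⟨ y , x ⟩     ≈⟨ K.*-congˡ (⟨⟩-conj x y) ⟨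
    ι 𝔽 t K.* ⟨ x , y ⟩              ∎
    where open SetoidReasoning K.setoid

  orthogonal-sym : ∀ {x y} → ⟨ x , y ⟩ K.≈ K.0# → ⟨ y , x ⟩ K.≈ K.0#
  orthogonal-sym p = K.trans (⟨⟩-conj _ _) (K.trans (conj-cong 𝔽 p) (conj-0 𝔽))

  ⟨⟩-real : ∀ x → ⟨ x , x ⟩ K.≈ ι 𝔽 ‖ x ‖²
  ⟨⟩-real x = self-conjugate⇒real 𝔽 (⟨⟩-conj x x)

  ‖‖²≈0⇒⟨⟩≈0 : ∀ {x} → ‖ x ‖² ℝ.≈ ℝ.0# → ⟨ x , x ⟩ K.≈ K.0#
  ‖‖²≈0⇒⟨⟩≈0 p = K.trans (⟨⟩-real _) (K.trans (ι-cong 𝔽 p) (ι-0 𝔽))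

  -- With more than `d` vectors `g q`, their coordinate rows in a basis satisfy a nontrivial
  -- relation. It carries over to the rows of the matrix `⟨ g q , h p ⟩`, whose triangular shape
  -- forces all coefficients to vanish.
  triangular⇒≤-dimension : HasDimension d →
    (level : Fin k → ℕ) (g h : Fin k → Carrierᴹ) →
    (∀ p → ¬ (⟨ g p , h p ⟩ K.≈ K.0#)) →
    (∀ q p → ¬ (⟨ g q , h p ⟩ K.≈ K.0#) → q ≡ p ⊎ level q ℕ.< level p) →
    k ℕ.≤ d
  triangular⇒≤-dimension {d} {k} (b , basis) level g h diagonal triangular = ℕₚ.≮⇒≥ d≮k
    where
    open IsBasis basis
    open SetoidReasoning K.setoid
    β : Fin k → Fin d → K.Carrier
    β q = proj₁ (spanning (g q))

    d≮k : ¬ (d ℕ.< k)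
    d≮k d<k with a , (q , a≉0) , rel ← nontrivial-kernel d<k β =
      a≉0 (triangular-kernel level (λ q p → ⟨ g q , h p ⟩) a diagonal triangular vanish q)
      where
      vanish : ∀ p → ΣK.sum (λ q → a q K.* ⟨ g q , h p ⟩) K.≈ K.0#
      vanish p = begin
        ΣK.sum (λ q → a q K.* ⟨ g q , h p ⟩)
          ≈⟨ ΣK.sum-cong-≋ {k} (λ q → K.*-congˡ (K.trans
               (⟨⟩-cong (proj₂ (spanning (g q))) ≈ᴹ-refl) (⟨⟩-combination (β q) b (h p)))) ⟩
        ΣK.sum (λ q → a q K.* ΣK.sum (λ i → β q i K.* ⟨ b i , h p ⟩))
          ≈⟨ sum-assoc a β _ ⟩
        ΣK.sum (λ i → ΣK.sum (λ q → a q K.* β q i) K.* ⟨ b i , h p ⟩)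
          ≈⟨ Supportᴷ.sum-zero {k = d} _ (λ i → K.trans (K.*-congʳ (rel i)) (K.zeroˡ _)) ⟩
        K.0# ∎

  -- Orthogonality to the `g i` is a system of `k` homogeneous linear equations for `d > k`
  -- coordinates, so it has a nontrivial solution; independence of the basis makes the resulting
  -- vector nonzero.
  orthogonal-vector : HasDimension d → k ℕ.< d → (g : Fin k → Carrierᴹ) →
    ∃ λ x → ¬ (⟨ x , x ⟩ K.≈ K.0#) × (∀ i → ⟨ x , g i ⟩ K.≈ K.0#)
  orthogonal-vector (b , basis) k<d g
    with a , (q , a≉0) , rel ← nontrivial-kernel k<d (λ q i → ⟨ b q , g i ⟩) =
    combination a b ,
    (λ p → a≉0 (IsBasis.independent basis a (⟨⟩-def _ p) q)) ,
    (λ i → K.trans (⟨⟩-combination a b (g i)) (rel i))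

  record Orthogonal {k} (e : Fin k → Carrierᴹ) : Set ℓ where
    field
      nonzero    : ∀ i → ¬ (⟨ e i , e i ⟩ K.≈ K.0#)
      orthogonal : ∀ i j → i ≢ j → ⟨ e i , e j ⟩ K.≈ K.0#

  ∷-orthogonal : ∀ {x} {e : Fin k → Carrierᴹ} → ¬ (⟨ x , x ⟩ K.≈ K.0#) →
    (∀ i → ⟨ x , e i ⟩ K.≈ K.0#) → Orthogonal e → Orthogonal (x ∷ e)
  ∷-orthogonal x≉0 x⊥e e⊥e = record
    { nonzero = λ where
        zero    → x≉0
        (suc i) → nonzero i
    ; orthogonal = λ where
        zero    zero    0≢0 → contradiction ≡.refl 0≢0
        zero    (suc j) _   → x⊥e j
        (suc i) zero    _   → orthogonal-sym (x⊥e i)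
        (suc i) (suc j) i≢j → orthogonal i j (i≢j ∘ ≡.cong suc)
    }
    where open Orthogonal e⊥e

  -- Each new vector comes from counting equations, in place of a Gram-Schmidt projection.
  orthogonal-system : HasDimension d → ∀ k → k ℕ.≤ d →
                      ∃ λ (e : Fin k → Carrierᴹ) → Orthogonal e
  orthogonal-system dim zero    _   = (λ ()) , record { nonzero = λ () ; orthogonal = λ () }
  orthogonal-system dim (suc k) k<d
    with e , e⊥e ← orthogonal-system dim k (ℕₚ.<⇒≤ k<d)
    with x , x≉0 , x⊥e ← orthogonal-vector dim k<d e = x ∷ e , ∷-orthogonal x≉0 x⊥e e⊥e

  -- The Gram matrix is diagonal, hence triangular even for a constant level.
  orthogonal⇒≤-dimension : HasDimension d → {e : Fin k → Carrierᴹ} → Orthogonal e → k ℕ.≤ d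
  orthogonal⇒≤-dimension dim {e} e⊥e = triangular⇒≤-dimension dim (λ _ → 0) e e nonzero
    (λ q p ≉0 → inj₁ (decidable-stable (q Finₚ.≟ p) λ q≢p → ≉0 (orthogonal q p q≢p)))
    where open Orthogonal e⊥e

  -- The vectors are left unnormalised to avoid square roots: `r` holds the squared norms and `t`
  -- their inverses, which weight the Parseval identity. That identity also expresses completeness
  -- of the system.
  record OrthogonalBasis (d : ℕ) : Set (c ⊔ ℓ ⊔ v) where
    field
      e          : Fin d → Carrierᴹ
      r t        : Fin d → ℝ.Carrier
      0<r        : ∀ i → ℝ.0# < r i
      0<t        : ∀ i → ℝ.0# < t i
      r*t≈1      : ∀ i → r i ℝ.* t i ℝ.≈ ℝ.1#
      norm       : ∀ i → ⟨ e i , e i ⟩ K.≈ ι 𝔽 (r i)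
      orthogonal : ∀ i j → i ≢ j → ⟨ e i , e j ⟩ K.≈ K.0#
      parseval   : ∀ x → ‖ x ‖² ℝ.≈ Σℝ.sum (λ i → t i ℝ.* ∣ 𝔽 ∋ ⟨ x , e i ⟩ ∣²)

  ι-sum : (s : Fin k → ℝ.Carrier) → ι 𝔽 (Σℝ.sum s) K.≈ ΣK.sum (λ i → ι 𝔽 (s i))
  ι-sum {zero}  s = ι-0 𝔽
  ι-sum {suc k} s = K.trans (ι-+ 𝔽 _ _) (K.+-congˡ (ι-sum (s ∘ suc)))

  ⟨combination,⟩ : (a : Fin k → K.Carrier) {e : Fin k → Carrierᴹ} →
    (∀ i j → i ≢ j → ⟨ e i , e j ⟩ K.≈ K.0#) →
    ∀ i → ⟨ combination a e , e i ⟩ K.≈ a i K.* ⟨ e i , e i ⟩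
  ⟨combination,⟩ {k} a {e} e⊥e i = K.trans (⟨⟩-combination a e (e i))
    (Supportᴷ.sum-single {k = k} _ i λ j j≢i → K.trans (K.*-congˡ (e⊥e j i j≢i)) (K.zeroʳ _))

  orthogonalBasis : HasDimension d → OrthogonalBasis d
  orthogonalBasis {d} dim with e , e⊥e ← orthogonal-system dim d ℕₚ.≤-refl = record
    { e          = e
    ; r          = λ i → ‖ e i ‖²
    ; t          = t
    ; 0<r        = 0<r
    ; 0<t        = λ i → proj₁ (proj₂ (positive-inverse (0<r i)))
    ; r*t≈1      = λ i → proj₂ (proj₂ (positive-inverse (0<r i)))
    ; norm       = λ i → ⟨⟩-real (e i)
    ; orthogonal = orthogonal
    ; parseval   = parseval
    }
    where
    open Orthogonal e⊥e
    open SetoidReasoning K.setoid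

    0<r : ∀ i → ℝ.0# < ‖ e i ‖²
    0<r i = nonneg∧≉0⇒pos (⟨⟩-nonneg (e i)) (nonzero i ∘ ‖‖²≈0⇒⟨⟩≈0)

    t : Fin d → ℝ.Carrier
    t i = proj₁ (positive-inverse (0<r i))

    -- A nonzero vector orthogonal to all `e i` would extend them to `d + 1` orthogonal vectors in
    -- dimension `d`.
    complement-trivial : ∀ x → (∀ i → ⟨ x , e i ⟩ K.≈ K.0#) → x ≈ᴹ 0ᴹ
    complement-trivial x x⊥e = ⟨⟩-def x (decidable-stable (zero? 𝔽 _) λ x≉0 →
      ℕₚ.1+n≰n (orthogonal⇒≤-dimension dim (∷-orthogonal x≉0 x⊥e e⊥e)))

    module _ (x : Carrierᴹ) where
      α : Fin d → K.Carrier
      α i = ι 𝔽 (t i) K.* ⟨ x , e i ⟩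

      projection residual : Carrierᴹ
      projection = combination α e
      -- The difference of `x` and its projection is orthogonal to every `e i`, hence zero.
      residual = x +ᴹ (K.- K.1#) *ₗ projection

      ⟨residual,⟩ : ∀ y → ⟨ residual , y ⟩ K.≈ ⟨ x , y ⟩ K.- ⟨ projection , y ⟩
      ⟨residual,⟩ y = K.trans (⟨⟩-+ _ _ y) (K.+-congˡ (K.trans (⟨⟩-* _ _ y) (-1*x≈-x _)))

      ⟨projection,e⟩ : ∀ i → ⟨ projection , e i ⟩ K.≈ ⟨ x , e i ⟩
      ⟨projection,e⟩ i = begin
        ⟨ projection , e i ⟩                               ≈⟨ ⟨combination,⟩ α orthogonal i ⟩
        ι 𝔽 (t i) K.* ⟨ x , e i ⟩ K.* ⟨ e i , e i ⟩        ≈⟨ K.*-congʳ (K.*-comm _ _) ⟩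
        ⟨ x , e i ⟩ K.* ι 𝔽 (t i) K.* ⟨ e i , e i ⟩        ≈⟨ K.*-assoc _ _ _ ⟩
        ⟨ x , e i ⟩ K.* (ι 𝔽 (t i) K.* ⟨ e i , e i ⟩)      ≈⟨ K.*-congˡ (K.*-congˡ (⟨⟩-real (e i))) ⟩
        ⟨ x , e i ⟩ K.* (ι 𝔽 (t i) K.* ι 𝔽 ‖ e i ‖²)       ≈⟨ K.*-congˡ (ι-* 𝔽 _ _) ⟨
        ⟨ x , e i ⟩ K.* ι 𝔽 (t i ℝ.* ‖ e i ‖²)             ≈⟨ K.*-congˡ (K.trans (ι-cong 𝔽 tr≈1) (ι-1 𝔽)) ⟩
        ⟨ x , e i ⟩ K.* K.1#                               ≈⟨ K.*-identityʳ _ ⟩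
        ⟨ x , e i ⟩                                        ∎
        where
        tr≈1 : t i ℝ.* ‖ e i ‖² ℝ.≈ ℝ.1#
        tr≈1 = ℝ.trans (ℝ.*-comm _ _) (proj₂ (proj₂ (positive-inverse (0<r i))))

      residual≈0 : residual ≈ᴹ 0ᴹ
      residual≈0 = complement-trivial residual λ i → K.trans (⟨residual,⟩ (e i))
        (K.trans (K.+-congˡ (K.-‿cong (⟨projection,e⟩ i))) (K.-‿inverseʳ _))

      ⟨projection,x⟩ : ⟨ x , x ⟩ K.≈ ⟨ projection , x ⟩
      ⟨projection,x⟩ = x∙y⁻¹≈ε⇒x≈y _ _ (K.trans (K.sym (⟨residual,⟩ x))
        (K.trans (⟨⟩-cong residual≈0 ≈ᴹ-refl) ⟨0, x ⟩))

      parseval : ‖ x ‖² ℝ.≈ Σℝ.sum (λ i → t i ℝ.* ∣ 𝔽 ∋ ⟨ x , e i ⟩ ∣²)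
      -- Only the first `x` is replaced by its projection; the factor `⟨ e i , x ⟩` is the conjugate
      -- of `⟨ x , e i ⟩`, so each term becomes a weighted squared modulus.
      parseval = ℝ.trans (re-cong 𝔽 (begin
        ⟨ x , x ⟩
          ≈⟨ ⟨projection,x⟩ ⟩
        ⟨ projection , x ⟩
          ≈⟨ ⟨⟩-combination α e x ⟩
        ΣK.sum (λ i → ι 𝔽 (t i) K.* ⟨ x , e i ⟩ K.* ⟨ e i , x ⟩)
          ≈⟨ ΣK.sum-cong-≋ {d} (λ i → K.trans (K.*-assoc _ _ _) (K.*-congˡ
               (K.trans (K.*-congˡ (⟨⟩-conj (e i) x)) (z*conj-z 𝔽 _)))) ⟩
        ΣK.sum (λ i → ι 𝔽 (t i) K.* ι 𝔽 ∣ 𝔽 ∋ ⟨ x , e i ⟩ ∣²)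
          ≈⟨ ΣK.sum-cong-≋ {d} (λ i → ι-* 𝔽 _ _) ⟨
        ΣK.sum (λ i → ι 𝔽 (t i ℝ.* ∣ 𝔽 ∋ ⟨ x , e i ⟩ ∣²))
          ≈⟨ ι-sum {d} _ ⟨
        ι 𝔽 (Σℝ.sum (λ i → t i ℝ.* ∣ 𝔽 ∋ ⟨ x , e i ⟩ ∣²)) ∎)) (re-ι 𝔽 _)

-- Frame bounds and spanning.

module Frames {ℝ : RealNumbers c ℓ} {𝔽 : Kind} (H : InnerProductSpace ℝ 𝔽 v w) where
  open InnerProductSpace H
  open InnerProducts H
  open OrderedField ℝ
  open Scalars ℝ
  open RealNumbers ℝ using (_<_; *-pos) renaming (_≤_ to _≤ℝ_)

  private
    module ℝ = CommutativeRing (RealNumbers.commutativeRing ℝ)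
    module K = CommutativeRing (scalars ℝ 𝔽)
    module Σℝ = SemiringSum ℝ.semiring
    module ΣK = SemiringSum K.semiring
    module Σᴹ = Sum +ᴹ-commutativeMonoid

  open SumSupport ℝ.+-commutativeMonoid

  module _ (T : Carrierᴹ → ℝ.Carrier) where

    -- The functional ⟨ _ , z ⟩ is bounded for the quadratic form T; such z
    -- form a subspace.
    Dominated : Carrierᴹ → Set _
    Dominated z = ∃ λ C → ∀ x → ∣ 𝔽 ∋ ⟨ x , z ⟩ ∣² ≤ℝ C ℝ.* T x

    dominated-≈ : ∀ {z z′} → z ≈ᴹ z′ → Dominated z → Dominated z′
    dominated-≈ z≈z′ (C , bound) = C , λ x →
      ≤-resp-≈ (∣∣²-cong 𝔽 (⟨⟩-cong ≈ᴹ-refl z≈z′)) ℝ.refl (bound x)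

    dominated-+ : ∀ {y z} → Dominated y → Dominated z → Dominated (y +ᴹ z)
    dominated-+ {y} {z} (C , p) (D , q) = C ℝ.+ D ℝ.+ (C ℝ.+ D) , λ x →
      ≤-resp-≈ (∣∣²-cong 𝔽 (K.sym (⟨⟩-+ʳ x y z)))
        (ℝ.sym (ℝ.trans (ℝ.distribʳ _ _ _) (ℝ.+-cong (ℝ.distribʳ _ _ _) (ℝ.distribʳ _ _ _))))
        (≤-trans (∣+∣²-≤ 𝔽 _ _) (+-mono-≤ (+-mono-≤ (p x) (q x)) (+-mono-≤ (p x) (q x))))

    dominated-ι* : ∀ s {z} → Dominated z → Dominated (ι 𝔽 s *ₗ z)
    dominated-ι* s {z} (C , p) = s ℝ.* s ℝ.* C , λ x →
      ≤-resp-≈ (ℝ.sym (ℝ.trans (∣∣²-cong 𝔽 (⟨⟩-ι*ʳ s x z)) (∣ι*∣² 𝔽 s _))) (ℝ.sym (ℝ.*-assoc _ _ _))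
        (*-monoˡ-≤ (square-nonneg s) (p x))

    dominated-0 : Dominated 0ᴹ
    dominated-0 = ℝ.0# , λ x → ≤-reflexive (ℝ.trans
      (∣∣²-cong 𝔽 (orthogonal-sym ⟨0, x ⟩)) (ℝ.trans (∣0∣² 𝔽) (ℝ.sym (ℝ.zeroˡ _))))

    -- A bound is asked for only where the coefficient is nonzero, which is what a triangular
    -- coefficient matrix can supply.
    dominated-combination : (a : Fin k → ℝ.Carrier) (b : Fin k → Carrierᴹ) →
      (∀ i → ¬ (a i ℝ.≈ ℝ.0#) → Dominated (b i)) → Dominated (combination (ι 𝔽 ∘ a) b)
    dominated-combination {zero}  a b p = dominated-0
    dominated-combination {suc k} a b p = dominated-+ head
      (dominated-combination (a ∘ suc) (b ∘ suc) (p ∘ suc))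
      where
      head : Dominated (ι 𝔽 (a zero) *ₗ b zero)
      head with a zero ≟ ℝ.0#
      ... | yes a≈0 = dominated-≈ (≈ᴹ-sym (≈ᴹ-trans
                        (*ₗ-cong (K.trans (ι-cong 𝔽 a≈0) (ι-0 𝔽)) ≈ᴹ-refl) (*ₗ-zeroˡ _))) dominated-0
      ... | no a≉0  = dominated-ι* (a zero) (p zero a≉0)

    -- Since `b i` has coefficient one, it equals the whole combination minus the remaining terms,
    -- all of which are dominated.
    dominated-pivot : (a : Fin k → ℝ.Carrier) (b : Fin k → Carrierᴹ) →
      ∀ i → a i ℝ.≈ ℝ.1# → (∀ j → j ≢ i → ¬ (a j ℝ.≈ ℝ.0#) → Dominated (b j)) →
      Dominated (combination (ι 𝔽 ∘ a) b) → Dominated (b i)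
    dominated-pivot {suc k} a b i aᵢ≈1 others whole = dominated-≈ solved
      (dominated-+ whole (dominated-ι* (ℝ.- ℝ.1#) (dominated-combination _ _
        (λ j → others (punchIn i j) (Finₚ.punchInᵢ≢i i j)))))
      where
      open SetoidReasoning ≈ᴹ-setoid
      rest : Carrierᴹ
      rest = combination (ι 𝔽 ∘ a ∘ punchIn i) (b ∘ punchIn i)

      1-1≈0 : K.1# K.+ ι 𝔽 (ℝ.- ℝ.1#) K.≈ K.0#
      1-1≈0 = K.trans (K.+-congʳ (K.sym (ι-1 𝔽))) (K.trans (K.sym (ι-+ 𝔽 _ _))
        (K.trans (ι-cong 𝔽 (ℝ.-‿inverseʳ ℝ.1#)) (ι-0 𝔽)))

      rest-cancels : rest +ᴹ ι 𝔽 (ℝ.- ℝ.1#) *ₗ rest ≈ᴹ 0ᴹ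
      rest-cancels = begin
        rest +ᴹ ι 𝔽 (ℝ.- ℝ.1#) *ₗ rest              ≈⟨ +ᴹ-congʳ (*ₗ-identityˡ rest) ⟨
        K.1# *ₗ rest +ᴹ ι 𝔽 (ℝ.- ℝ.1#) *ₗ rest      ≈⟨ *ₗ-distribʳ rest _ _ ⟨
        (K.1# K.+ ι 𝔽 (ℝ.- ℝ.1#)) *ₗ rest           ≈⟨ *ₗ-cong 1-1≈0 ≈ᴹ-refl ⟩
        K.0# *ₗ rest                                ≈⟨ *ₗ-zeroˡ rest ⟩
        0ᴹ                                          ∎

      solved : combination (ι 𝔽 ∘ a) b +ᴹ ι 𝔽 (ℝ.- ℝ.1#) *ₗ rest ≈ᴹ b i
      solved = begin
        combination (ι 𝔽 ∘ a) b +ᴹ ι 𝔽 (ℝ.- ℝ.1#) *ₗ rest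
          ≈⟨ +ᴹ-congʳ (Σᴹ.sum-remove {i = i} (λ j → ι 𝔽 (a j) *ₗ b j)) ⟩
        ι 𝔽 (a i) *ₗ b i +ᴹ rest +ᴹ ι 𝔽 (ℝ.- ℝ.1#) *ₗ rest
          ≈⟨ +ᴹ-assoc _ _ _ ⟩
        ι 𝔽 (a i) *ₗ b i +ᴹ (rest +ᴹ ι 𝔽 (ℝ.- ℝ.1#) *ₗ rest)
          ≈⟨ +ᴹ-cong (*ₗ-cong (K.trans (ι-cong 𝔽 aᵢ≈1) (ι-1 𝔽)) ≈ᴹ-refl) rest-cancels ⟩
        K.1# *ₗ b i +ᴹ 0ᴹ
          ≈⟨ ≈ᴹ-trans (+ᴹ-identityʳ _) (*ₗ-identityˡ _) ⟩
        b i ∎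

    -- Gives both frame bounds: the lower one with `T` the frame sum and `b` the orthogonal basis,
    -- the upper one with `T` the squared norm and `b` the frame.
    sum-dominated : (∀ x → ℝ.0# ≤ℝ T x) →
      (s : Fin k → ℝ.Carrier) (b : Fin k → Carrierᴹ) → (∀ i → ℝ.0# ≤ℝ s i) →
      (∀ i → Dominated (b i)) →
      ∃ λ C → ℝ.0# ≤ℝ C × ∀ x → Σℝ.sum (λ i → s i ℝ.* ∣ 𝔽 ∋ ⟨ x , b i ⟩ ∣²) ≤ℝ C ℝ.* T x
    sum-dominated {k} T-nonneg s b 0≤s p = Σℝ.sum C , sum-nonneg C 0≤C , λ x → ≤-trans
      (sum-mono-≤ {k} _ _ (bound x)) (≤-reflexive (ℝ.sym (Σℝ.*-distribʳ-sum {k} (T x) C)))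
      where
      C : Fin k → ℝ.Carrier
      -- The constant from `Dominated` may be negative; its square plus one is a nonnegative upper
      -- bound for it.
      C i = s i ℝ.* (proj₁ (p i) ℝ.* proj₁ (p i) ℝ.+ ℝ.1#)
      0≤C : ∀ i → ℝ.0# ≤ℝ C i
      0≤C i = *-nonneg (0≤s i) (+-nonneg (square-nonneg _) (inj₁ 0<1))
      bound : ∀ x i → s i ℝ.* ∣ 𝔽 ∋ ⟨ x , b i ⟩ ∣² ≤ℝ C i ℝ.* T x
      bound x i = ≤-trans (*-monoˡ-≤ (0≤s i) (≤-trans (proj₂ (p i) x)
        (*-monoʳ-≤ (T-nonneg x) (x≤x²+1 _)))) (≤-reflexive (ℝ.sym (ℝ.*-assoc _ _ _)))

  module _ (E : OrthogonalBasis d) where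
    open OrthogonalBasis E

    gram : (a b : Fin d → ℝ.Carrier) →
      ⟨ combination (ι 𝔽 ∘ a) e , combination (ι 𝔽 ∘ b) e ⟩ K.≈
      ι 𝔽 (Σℝ.sum (λ i → a i ℝ.* (b i ℝ.* r i)))
    gram a b = begin
      ⟨ combination (ι 𝔽 ∘ a) e , B ⟩             ≈⟨ ⟨⟩-combination (ι 𝔽 ∘ a) e B ⟩
      ΣK.sum (λ i → ι 𝔽 (a i) K.* ⟨ e i , B ⟩)    ≈⟨ ΣK.sum-cong-≋ {d} (λ i →
                                                       K.trans (K.*-congˡ (⟨e,B⟩ i)) (K.sym (ι-* 𝔽 _ _))) ⟩
      ΣK.sum (λ i → ι 𝔽 (a i ℝ.* (b i ℝ.* r i)))  ≈⟨ ι-sum {k = d} _ ⟨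
      ι 𝔽 (Σℝ.sum (λ i → a i ℝ.* (b i ℝ.* r i)))  ∎
      where
      open SetoidReasoning K.setoid
      B = combination (ι 𝔽 ∘ b) e
      ⟨e,B⟩ : ∀ i → ⟨ e i , B ⟩ K.≈ ι 𝔽 (b i ℝ.* r i)
      ⟨e,B⟩ i = begin
        ⟨ e i , B ⟩                               ≈⟨ ⟨⟩-conj _ _ ⟩
        conj ℝ 𝔽 ⟨ B , e i ⟩                      ≈⟨ conj-cong 𝔽 (⟨combination,⟩ (ι 𝔽 ∘ b) orthogonal i) ⟩
        conj ℝ 𝔽 (ι 𝔽 (b i) K.* ⟨ e i , e i ⟩)    ≈⟨ conj-cong 𝔽 (K.trans (K.*-congˡ (norm i)) (K.sym (ι-* 𝔽 _ _))) ⟩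
        conj ℝ 𝔽 (ι 𝔽 (b i ℝ.* r i))              ≈⟨ conj-ι 𝔽 _ ⟩
        ι 𝔽 (b i ℝ.* r i)                         ∎

    -- The σ k-th vectors are triangular in the basis e, hence already span.
    triangular⇒frame : ∀ {N} (a : Fin N → Fin d → ℝ.Carrier) (σ : Fin d → Fin N) (level : Fin d → ℕ) →
      (∀ i → a (σ i) i ℝ.≈ ℝ.1#) →
      (∀ i j → ¬ (a (σ i) j ℝ.≈ ℝ.0#) → j ≡ i ⊎ level j ℕ.< level i) →
      IsFrame (λ u → combination (ι 𝔽 ∘ a u) e)
    triangular⇒frame {N} a σ level diagonal triangular = A , B , 0<A , A≤B , λ x →
      lower x , upper x
      where
      f : Fin N → Carrierᴹ
      f u = combination (ι 𝔽 ∘ a u) e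

      S : Carrierᴹ → ℝ.Carrier
      S x = Σℝ.sum (λ u → ∣ 𝔽 ∋ ⟨ x , f u ⟩ ∣²)

      S-nonneg : ∀ x → ℝ.0# ≤ℝ S x
      S-nonneg x = sum-nonneg {N} _ (λ _ → ∣∣²-nonneg 𝔽 _)

      f-dominated : ∀ u → Dominated S (f u)
      f-dominated u = ℝ.1# , λ x → ≤-trans (term≤sum {N} _ (λ _ → ∣∣²-nonneg 𝔽 _) u)
        (≤-reflexive (ℝ.sym (ℝ.*-identityˡ _)))

      -- Induction on the level: `f (σ i)` is `e i` plus a combination of basis vectors of lower
      -- level.
      e-dominated : ∀ l i → level i ℕ.< l → Dominated S (e i)
      e-dominated (suc l) i (s≤s i≤l) = dominated-pivot S (a (σ i)) e i (diagonal i) others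
        (f-dominated (σ i))
        where
        others : ∀ j → j ≢ i → ¬ (a (σ i) j ℝ.≈ ℝ.0#) → Dominated S (e j)
        others j j≢i a≉0 with triangular i j a≉0
        ... | inj₁ j≡i = contradiction j≡i j≢i
        ... | inj₂ j<i = e-dominated l j (ℕₚ.<-≤-trans j<i i≤l)

      -- One term of the Parseval sum is at most the whole sum; the factor `r i` removes its weight
      -- `t i`.
      e-bounded : ∀ i → Dominated ‖_‖² (e i)
      e-bounded i = r i , λ x → ≤-trans (≤-reflexive (ℝ.sym (begin
          r i ℝ.* (t i ℝ.* ∣ 𝔽 ∋ ⟨ x , e i ⟩ ∣²)   ≈⟨ ℝ.*-assoc _ _ _ ⟨
          r i ℝ.* t i ℝ.* ∣ 𝔽 ∋ ⟨ x , e i ⟩ ∣²     ≈⟨ ℝ.*-congʳ (r*t≈1 i) ⟩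
          ℝ.1# ℝ.* ∣ 𝔽 ∋ ⟨ x , e i ⟩ ∣²            ≈⟨ ℝ.*-identityˡ _ ⟩
          ∣ 𝔽 ∋ ⟨ x , e i ⟩ ∣²                     ∎)))
        (*-monoˡ-≤ (inj₁ (0<r i)) (≤-trans
          (term≤sum {d} _ (λ j → *-nonneg (inj₁ (0<t j)) (∣∣²-nonneg 𝔽 _)) i)
          (≤-reflexive (ℝ.sym (parseval x)))))
        where open SetoidReasoning ℝ.setoid

      f-bounded : ∀ u → Dominated ‖_‖² (f u)
      f-bounded u = dominated-combination ‖_‖² (a u) e (λ i _ → e-bounded i)

      lower′ = sum-dominated S S-nonneg t e (inj₁ ∘ 0<t) (λ i → e-dominated _ i ℕₚ.≤-refl)
      upper′ = sum-dominated ‖_‖² ⟨⟩-nonneg (λ _ → ℝ.1#) f (λ _ → inj₁ 0<1) f-bounded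

      C D : ℝ.Carrier
      C = proj₁ lower′
      D = proj₁ upper′

      -- `C` is only known to be nonnegative; adding one makes it invertible.
      0<C+1 : ℝ.0# < C ℝ.+ ℝ.1#
      0<C+1 = <-≤-trans 0<1 (≤-trans (x≤x+y (proj₁ (proj₂ lower′))) (≤-reflexive (ℝ.+-comm _ _)))

      -- The lower bound is the inverse of `C + 1`. Adding `A` to the upper constant `D` makes
      -- `A ≤ B` immediate.
      A B : ℝ.Carrier
      A = proj₁ (positive-inverse 0<C+1)
      B = A ℝ.+ D

      0<A : ℝ.0# < A
      0<A = proj₁ (proj₂ (positive-inverse 0<C+1))

      A≤B : A ≤ℝ B
      A≤B = x≤x+y (proj₁ (proj₂ upper′))

      lower : ∀ x → A ℝ.* ‖ x ‖² ≤ℝ S x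
      lower x = ≤-trans (*-monoˡ-≤ (inj₁ 0<A) (≤-trans (≤-reflexive (parseval x))
          (≤-trans (proj₂ (proj₂ lower′) x) (*-monoʳ-≤ (S-nonneg x) (x≤x+y (inj₁ 0<1))))))
        (≤-reflexive (begin
          A ℝ.* ((C ℝ.+ ℝ.1#) ℝ.* S x)   ≈⟨ ℝ.*-assoc _ _ _ ⟨
          A ℝ.* (C ℝ.+ ℝ.1#) ℝ.* S x     ≈⟨ ℝ.*-congʳ (ℝ.*-comm _ _) ⟩
          (C ℝ.+ ℝ.1#) ℝ.* A ℝ.* S x     ≈⟨ ℝ.*-congʳ (proj₂ (proj₂ (positive-inverse 0<C+1))) ⟩
          ℝ.1# ℝ.* S x                   ≈⟨ ℝ.*-identityˡ _ ⟩
          S x                            ∎))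
        where open SetoidReasoning ℝ.setoid

      upper : ∀ x → S x ≤ℝ B ℝ.* ‖ x ‖²
      upper x = ≤-trans (≤-reflexive (Σℝ.sum-cong-≋ {N} (λ _ → ℝ.sym (ℝ.*-identityˡ _))))
        (≤-trans (proj₂ (proj₂ upper′) x) (*-monoʳ-≤ (⟨⟩-nonneg x)
          (≤-trans (x≤x+y (inj₁ 0<A)) (≤-reflexive (ℝ.+-comm _ _)))))

  -- Fewer than `d` vectors leave a nonzero `x` orthogonal to all of them; its frame sum is zero,
  -- against the positive lower bound.
  frame⇒dimension≤ : HasDimension d → ∀ {N} (f : Fin N → Carrierᴹ) → IsFrame f → d ℕ.≤ N
  frame⇒dimension≤ {d} dim {N} f (A , B , 0<A , _ , bounds) = ℕₚ.≮⇒≥ N≮d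
    where
    N≮d : ¬ (N ℕ.< d)
    N≮d N<d with x , x≉0 , x⊥f ← orthogonal-vector dim N<d f =
      <-irrefl ℝ.refl (<-≤-trans (*-pos A ‖ x ‖² 0<A 0<‖x‖²) (≤-trans (proj₁ (bounds x))
        (≤-reflexive (sum-zero {k = N} _ λ i → ℝ.trans (∣∣²-cong 𝔽 (x⊥f i)) (∣0∣² 𝔽)))))
      where
      0<‖x‖² : ℝ.0# < ‖ x ‖²
      0<‖x‖² = nonneg∧≉0⇒pos (⟨⟩-nonneg x) (x≉0 ∘ ‖‖²≈0⇒⟨⟩≈0)

-- Combinatorics of paths and of the grid.

remQuot-injective : ∀ {n} m {k l : Fin (n ℕ.* m)} → remQuot {n} m k ≡ remQuot m l → k ≡ l
remQuot-injective {n} m = Injection.injective (↔⇒↣ (Finₚ.*↔× {n} {m}))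

module _ {n : ℕ} where

  -- With equality included in adjacency, the strong product becomes the componentwise product of
  -- relations.
  Near : Fin n → Fin n → Set
  Near i j = i ≡ j ⊎ Graph.Adj (Path n) i j

  -- i is an endpoint of the path edge {p, p+1}, truncated to {p} when p is
  -- the last vertex.
  _∈ₑ_ : Fin n → Fin n → Set
  i ∈ₑ p = toℕ i ≡ toℕ p ⊎ toℕ i ≡ suc (toℕ p)

  ∈ₑ⇒near : ∀ {i j p} → i ∈ₑ p → j ∈ₑ p → Near i j
  ∈ₑ⇒near (inj₁ i≡p) (inj₁ j≡p) = inj₁ (Finₚ.toℕ-injective (≡.trans i≡p (≡.sym j≡p)))
  ∈ₑ⇒near (inj₁ i≡p) (inj₂ j≡)  = inj₂ (inj₁ (≡.trans j≡ (≡.cong suc (≡.sym i≡p))))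
  ∈ₑ⇒near (inj₂ i≡)  (inj₁ j≡p) = inj₂ (inj₂ (≡.trans i≡ (≡.cong suc (≡.sym j≡p))))
  ∈ₑ⇒near (inj₂ i≡)  (inj₂ j≡)  = inj₁ (Finₚ.toℕ-injective (≡.trans i≡ (≡.sym j≡)))

  ∈ₑ⇒≡⊎< : ∀ {i p} → i ∈ₑ p → p ≡ i ⊎ toℕ p ℕ.< toℕ i
  ∈ₑ⇒≡⊎< (inj₁ i≡p) = inj₁ (≡.sym (Finₚ.toℕ-injective i≡p))
  ∈ₑ⇒≡⊎< (inj₂ i≡)  = inj₂ (ℕₚ.≤-reflexive (≡.sym i≡))

  _∈ₑ?_ : ∀ i p → Dec (i ∈ₑ p)
  i ∈ₑ? p = (toℕ i ℕₚ.≟ toℕ p) ⊎-dec (toℕ i ℕₚ.≟ suc (toℕ p))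

-- The index `inject₁ p` always denotes a full edge, never the truncated one. A pair of equal
-- vertices uses the edge to the left, except at vertex zero, which uses the edge to the right.
near⇒∈ₑ : ∀ {n} {i j : Fin (2 ℕ.+ n)} → Near i j →
          ∃ λ (p : Fin (suc n)) → i ∈ₑ inject₁ p × j ∈ₑ inject₁ p
near⇒∈ₑ {i = zero}  (inj₁ ≡.refl) = zero , inj₁ ≡.refl , inj₁ ≡.refl
near⇒∈ₑ {i = suc p} (inj₁ ≡.refl) = p , inj₂ p≡ , inj₂ p≡
  where p≡ = ≡.cong suc (≡.sym (Finₚ.toℕ-inject₁ p))
near⇒∈ₑ {j = suc p} (inj₂ (inj₁ j≡)) =
  p , inj₁ (≡.trans (≡.sym (ℕₚ.suc-injective j≡)) (≡.sym (Finₚ.toℕ-inject₁ p))) ,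
  inj₂ (≡.cong suc (≡.sym (Finₚ.toℕ-inject₁ p)))
near⇒∈ₑ {i = suc p} (inj₂ (inj₂ i≡)) =
  p , inj₂ (≡.cong suc (≡.sym (Finₚ.toℕ-inject₁ p))) ,
  inj₁ (≡.trans (≡.sym (ℕₚ.suc-injective i≡)) (≡.sym (Finₚ.toℕ-inject₁ p)))

-- Nearness of `q + 1` and `p` leaves `p` only the values `q`, `q + 1` and `q + 2`. This is the
-- triangularity of the lower bound in one coordinate.
near-suc-inject₁⇒≡⊎< : ∀ {n} {p q : Fin n} → Near (suc q) (inject₁ p) →
                       q ≡ p ⊎ toℕ q ℕ.< toℕ p
near-suc-inject₁⇒≡⊎< {p = p} near = Sum⊎.map₁ Finₚ.toℕ-injective (cases near)
  where
  p≡ = Finₚ.toℕ-inject₁ p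
  cases : ∀ {q} → Near (suc q) (inject₁ p) → toℕ q ≡ toℕ p ⊎ toℕ q ℕ.< toℕ p
  cases (inj₁ eq)        = inj₂ (ℕₚ.≤-reflexive (≡.trans (≡.cong toℕ eq) p≡))
  cases (inj₂ (inj₁ eq)) = inj₂ (ℕₚ.<⇒≤ (ℕₚ.≤-reflexive (≡.trans (≡.sym eq) p≡)))
  cases (inj₂ (inj₂ eq)) = inj₁ (ℕₚ.suc-injective (≡.trans eq (≡.cong suc p≡)))

module _ {n m : ℕ} where

  strong⇒near : ∀ {u v} → Graph.Adj (Path n ⊠ Path m) u v →
                Near (proj₁ u) (proj₁ v) × Near (proj₂ u) (proj₂ v)
  strong⇒near (inj₁ (p , a))        = inj₁ p , inj₂ a
  strong⇒near (inj₂ (inj₁ (p , a))) = inj₂ a , inj₁ p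
  strong⇒near (inj₂ (inj₂ (a , b))) = inj₂ a , inj₂ b

  near⇒strong : ∀ {u v} → u ≢ v → Near (proj₁ u) (proj₁ v) → Near (proj₂ u) (proj₂ v) →
                Graph.Adj (Path n ⊠ Path m) u v
  near⇒strong u≢v (inj₁ p) (inj₁ q) = contradiction (≡.cong₂ _,_ p q) u≢v
  near⇒strong u≢v (inj₁ p) (inj₂ b) = inj₁ (p , b)
  near⇒strong u≢v (inj₂ a) (inj₁ q) = inj₂ (inj₁ (q , a))
  near⇒strong u≢v (inj₂ a) (inj₂ b) = inj₂ (inj₂ (a , b))

  -- A numerical rank, strictly increasing in the componentwise order, that serves both
  -- triangularity arguments.
  level : Fin n × Fin m → ℕ
  level (i , j) = toℕ i ℕ.+ toℕ j

  componentwise⇒level : ∀ {u v : Fin n × Fin m} →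
    proj₁ u ≡ proj₁ v ⊎ toℕ (proj₁ u) ℕ.< toℕ (proj₁ v) →
    proj₂ u ≡ proj₂ v ⊎ toℕ (proj₂ u) ℕ.< toℕ (proj₂ v) →
    u ≡ v ⊎ level u ℕ.< level v
  componentwise⇒level (inj₁ p)      (inj₁ q)      = inj₁ (≡.cong₂ _,_ p q)
  componentwise⇒level (inj₁ ≡.refl) (inj₂ q)      = inj₂ (ℕₚ.+-monoʳ-< _ q)
  componentwise⇒level (inj₂ p)      (inj₁ ≡.refl) = inj₂ (ℕₚ.+-monoˡ-< _ p)
  componentwise⇒level (inj₂ p)      (inj₂ q)      = inj₂ (ℕₚ.+-mono-< p q)

  -- A clique is represented by its corner with the least coordinates, so the grid points index the
  -- cliques.
  _∈_ : Fin n × Fin m → Fin n × Fin m → Set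
  (i , j) ∈ (p , q) = i ∈ₑ p × j ∈ₑ q

  _∈?_ : ∀ u s → Dec (u ∈ s)
  (i , j) ∈? (p , q) = (i ∈ₑ? p) ×-dec (j ∈ₑ? q)

  ∈-refl : ∀ u → u ∈ u
  ∈-refl u = inj₁ ≡.refl , inj₁ ≡.refl

  ∈⇒level : ∀ {u s} → u ∈ s → s ≡ u ⊎ level s ℕ.< level u
  ∈⇒level (i∈p , j∈q) = componentwise⇒level (∈ₑ⇒≡⊎< i∈p) (∈ₑ⇒≡⊎< j∈q)

-- The vertices of the grid, listed with the last row and the last column
-- at the end.
module Enumeration (n m : ℕ) where

  Grid : Set
  Grid = Fin (suc n) × Fin (suc m)

  total : ℕ
  total = n ℕ.* m ℕ.+ (suc n ℕ.+ m)

  total≡ : total ≡ suc n ℕ.* suc m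
  total≡ = solve 2 (λ n m → n :* m :+ (con 1 :+ n :+ m) := (con 1 :+ n) :* (con 1 :+ m))
                   ≡.refl n m
    where open +-*-Solver

  -- The three blocks are the interior corners, the full last column, and the last row without the
  -- corner already listed in that column.
  place : Fin (n ℕ.* m) ⊎ (Fin (suc n) ⊎ Fin m) → Grid
  place (inj₁ k)        = inject₁ (proj₁ (remQuot m k)) , inject₁ (proj₂ (remQuot {n} m k))
  place (inj₂ (inj₁ i)) = i , fromℕ m
  place (inj₂ (inj₂ j)) = fromℕ n , inject₁ j

  place-injective : ∀ x y → place x ≡ place y → x ≡ y
  place-injective (inj₁ k) (inj₁ l) eq = ≡.cong inj₁ (remQuot-injective m (≡.cong₂ _,_
      (Finₚ.inject₁-injective (≡.cong proj₁ eq)) (Finₚ.inject₁-injective (≡.cong proj₂ eq))))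
  place-injective (inj₁ k) (inj₂ (inj₁ i)) eq = contradiction (≡.sym (≡.cong proj₂ eq)) Finₚ.fromℕ≢inject₁
  place-injective (inj₁ k) (inj₂ (inj₂ j)) eq = contradiction (≡.sym (≡.cong proj₁ eq)) Finₚ.fromℕ≢inject₁
  place-injective (inj₂ (inj₁ i)) (inj₁ k) eq = contradiction (≡.cong proj₂ eq) Finₚ.fromℕ≢inject₁
  place-injective (inj₂ (inj₂ j)) (inj₁ k) eq = contradiction (≡.cong proj₁ eq) Finₚ.fromℕ≢inject₁
  place-injective (inj₂ (inj₁ i)) (inj₂ (inj₁ j)) eq = ≡.cong (inj₂ ∘ inj₁) (≡.cong proj₁ eq)
  place-injective (inj₂ (inj₁ i)) (inj₂ (inj₂ j)) eq = contradiction (≡.cong proj₂ eq) Finₚ.fromℕ≢inject₁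
  place-injective (inj₂ (inj₂ j)) (inj₂ (inj₁ i)) eq = contradiction (≡.sym (≡.cong proj₂ eq)) Finₚ.fromℕ≢inject₁
  place-injective (inj₂ (inj₂ i)) (inj₂ (inj₂ j)) eq =
    ≡.cong (inj₂ ∘ inj₂) (Finₚ.inject₁-injective (≡.cong proj₂ eq))

  split : Fin total → Fin (n ℕ.* m) ⊎ (Fin (suc n) ⊎ Fin m)
  split = Sum⊎.map₂ (splitAt (suc n)) ∘ splitAt (n ℕ.* m)

  split-injective : ∀ {k l} → split k ≡ split l → k ≡ l
  split-injective eq = splitAt-injective (n ℕ.* m) (map₂-injective _ _ eq)
    where
    splitAt-injective : ∀ a {b} {k l : Fin (a ℕ.+ b)} → splitAt a k ≡ splitAt a l → k ≡ l
    splitAt-injective a {b} = Injection.injective (↔⇒↣ (Finₚ.+↔⊎ {a} {b}))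
    map₂-injective : ∀ x y → Sum⊎.map₂ (splitAt (suc n)) x ≡ Sum⊎.map₂ (splitAt (suc n)) y → x ≡ y
    map₂-injective (inj₁ x) (inj₁ y) eq = ≡.cong inj₁ (Sumₚ.inj₁-injective eq)
    map₂-injective (inj₂ x) (inj₂ y) eq =
      ≡.cong inj₂ (splitAt-injective (suc n) (Sumₚ.inj₂-injective eq))

  module _ {d : ℕ} (nm≤d : n ℕ.* m ℕ.≤ d) (d≤ : d ℕ.≤ suc n ℕ.* suc m) where

    private
      d≤total : d ℕ.≤ total
      d≤total = ℕₚ.≤-trans d≤ (ℕₚ.≤-reflexive (≡.sym total≡))

    -- An initial segment of length `d` of the list; as `n * m ≤ d`, it includes the whole first
    -- block.
    cell : Fin d → Grid
    cell k = place (split (inject≤ k d≤total))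

    cell-injective : ∀ k l → cell k ≡ cell l → k ≡ l
    cell-injective k l eq = Finₚ.inject≤-injective d≤total d≤total k l
      (split-injective (place-injective _ _ eq))

    cell-onto-interior : ∀ p q → ∃ λ k → cell k ≡ (inject₁ p , inject₁ q)
    cell-onto-interior p q = inject≤ i nm≤d , (begin
      place (split (inject≤ (inject≤ i nm≤d) d≤total))  ≡⟨ ≡.cong (place ∘ split) same ⟩
      place (split (i ↑ˡ (suc n ℕ.+ m)))                ≡⟨ ≡.cong (place ∘ Sum⊎.map₂ (splitAt (suc n))) (Finₚ.splitAt-↑ˡ (n ℕ.* m) i _) ⟩
      place (inj₁ i)                                    ≡⟨ ≡.cong (λ (p , q) → inject₁ p , inject₁ q) (Finₚ.remQuot-combine p q) ⟩
      (inject₁ p , inject₁ q)                           ∎)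
      where
      open ≡.≡-Reasoning
      i = combine p q
      same : inject≤ (inject≤ i nm≤d) d≤total ≡ i ↑ˡ (suc n ℕ.+ m)
      same = Finₚ.toℕ-injective (≡.trans (Finₚ.toℕ-inject≤ _ _)
        (≡.trans (Finₚ.toℕ-inject≤ i _) (≡.sym (Finₚ.toℕ-↑ˡ i _))))

-- Realisation by cliques, and necessity of the dimension bounds.

module _ {ℝ : RealNumbers c ℓ} {𝔽 : Kind} (H : InnerProductSpace ℝ 𝔽 v w) where
  open InnerProductSpace H
  open InnerProducts H
  open Frames H
  open OrderedField ℝ
  open Scalars ℝ
  open RealNumbers ℝ using () renaming (_≤_ to _≤ℝ_)

  private
    module ℝ = CommutativeRing (RealNumbers.commutativeRing ℝ)
    module K = CommutativeRing (scalars ℝ 𝔽)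
  open SumSupport ℝ.+-commutativeMonoid using (sum-zero)

  indicator : ∀ {p} {P : Set p} → Dec P → ℝ.Carrier
  indicator (yes _) = ℝ.1#
  indicator (no _)  = ℝ.0#

  indicator-nonneg : ∀ {p} {P : Set p} (P? : Dec P) → ℝ.0# ≤ℝ indicator P?
  indicator-nonneg (yes _) = inj₁ 0<1
  indicator-nonneg (no _)  = ≤-refl

  indicator≈1 : ∀ {p} {P : Set p} (P? : Dec P) → P → indicator P? ℝ.≈ ℝ.1#
  indicator≈1 (yes _)  _ = ℝ.refl
  indicator≈1 (no ¬p)  p = contradiction p ¬p

  indicator≉0 : ∀ {p} {P : Set p} (P? : Dec P) → ¬ (indicator P? ℝ.≈ ℝ.0#) → P
  indicator≉0 (yes p) _   = p
  indicator≉0 (no _)  0≉0 = contradiction ℝ.refl 0≉0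

  indicator-disjoint : ∀ {p q} {P : Set p} {Q : Set q} (P? : Dec P) (Q? : Dec Q) {t} →
    ¬ (P × Q) → indicator P? ℝ.* (indicator Q? ℝ.* t) ℝ.≈ ℝ.0#
  indicator-disjoint (yes p) (yes q) ¬pq = contradiction (p , q) ¬pq
  indicator-disjoint (no _)  _       _   = ℝ.zeroˡ _
  indicator-disjoint (yes _) (no _)  _   = ℝ.trans (ℝ.*-congˡ (ℝ.zeroˡ _)) (ℝ.zeroʳ _)

  realisation : ∀ n m → OrthogonalBasis d →
    suc n ℕ.* suc m ℕ.≤ d → d ℕ.≤ (2 ℕ.+ n) ℕ.* (2 ℕ.+ m) →
    IsFrameGraphIn H (Path (2 ℕ.+ n) ⊠ Path (2 ℕ.+ m))
  realisation {d} n m E lower upper = N , f , frame , iso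
    where
    -- The parameters are numbers of path edges, one less than the numbers of vertices.
    open Enumeration (suc n) (suc m)
    open OrthogonalBasis E

    N : ℕ
    N = (2 ℕ.+ n) ℕ.* (2 ℕ.+ m)

    vertex : Fin N → Grid
    vertex = remQuot (2 ℕ.+ m)

    s : Fin d → Grid
    s = cell lower upper

    a : Fin N → Fin d → ℝ.Carrier
    a u k = indicator (vertex u ∈? s k)

    f : Fin N → Carrierᴹ
    f u = combination (ι 𝔽 ∘ a u) e

    pivot : Fin d → Fin N
    pivot k = combine (proj₁ (s k)) (proj₂ (s k))

    vertex-pivot : ∀ k → vertex (pivot k) ≡ s k
    vertex-pivot k = Finₚ.remQuot-combine (proj₁ (s k)) (proj₂ (s k))

    -- The vertex at the corner of clique `k` lies in that clique, and any other chosen clique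
    -- containing it has a corner of lower level.
    frame : IsFrame f
    frame = triangular⇒frame E a pivot (level ∘ s)
      (λ k → indicator≈1 (vertex (pivot k) ∈? s k)
               (≡.subst (_∈ s k) (≡.sym (vertex-pivot k)) (∈-refl (s k))))
      (λ k l a≉0 → case-level k l (∈⇒level (≡.subst (_∈ s l) (vertex-pivot k)
         (indicator≉0 (vertex (pivot k) ∈? s l) a≉0))))
      where
      case-level : ∀ k l → s l ≡ s k ⊎ level (s l) ℕ.< level (s k) →
                   l ≡ k ⊎ level (s l) ℕ.< level (s k)
      case-level k l = Sum⊎.map₁ (cell-injective lower upper l k)

    products : Fin N → Fin N → Fin d → ℝ.Carrier
    products u v k = a u k ℝ.* (a v k ℝ.* r k)

    -- All terms of the Gram sum are nonnegative, so the positive term `r k` of the common clique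
    -- cannot cancel.
    share⇒≉0 : ∀ u v k → vertex u ∈ s k → vertex v ∈ s k → ¬ (⟨ f u , f v ⟩ K.≈ K.0#)
    share⇒≉0 u v k u∈ v∈ ≈0 = pos⇒≉0
      (<-≤-trans (0<r k) (≤-trans (≤-reflexive (ℝ.sym rₖ))
        (term≤sum (products u v) nonneg k)))
      (ι≈0⇒≈0 𝔽 (K.trans (K.sym (gram E (a u) (a v))) ≈0))
      where
      nonneg : ∀ l → ℝ.0# ≤ℝ products u v l
      nonneg l = *-nonneg (indicator-nonneg (vertex u ∈? s l))
        (*-nonneg (indicator-nonneg (vertex v ∈? s l)) (inj₁ (0<r l)))
      rₖ : products u v k ℝ.≈ r k
      rₖ = ℝ.trans (ℝ.*-cong (indicator≈1 (vertex u ∈? s k) u∈)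
             (ℝ.*-congʳ (indicator≈1 (vertex v ∈? s k) v∈)))
             (ℝ.trans (ℝ.*-identityˡ _) (ℝ.*-identityˡ _))

    ≉0⇒share : ∀ u v → ¬ (⟨ f u , f v ⟩ K.≈ K.0#) → ∃ λ k → vertex u ∈ s k × vertex v ∈ s k
    ≉0⇒share u v ≉0 = decidable-stable
      (Finₚ.any? (λ k → (vertex u ∈? s k) ×-dec (vertex v ∈? s k))) λ none →
      ≉0 (K.trans (gram E (a u) (a v)) (K.trans (ι-cong 𝔽 (sum-zero {k = d} _
        (λ k → indicator-disjoint (vertex u ∈? s k) (vertex v ∈? s k) (λ both → none (k , both)))))
        (ι-0 𝔽)))

    iso : frameGraph H f ≅ (Path (2 ℕ.+ n) ⊠ Path (2 ℕ.+ m))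
    iso = record { bijection = Finₚ.*↔× ; adjacency = λ u v → mk⇔ (to u v) (from u v) }
      where
      to : ∀ u v → u ≢ v × ¬ (⟨ f u , f v ⟩ K.≈ K.0#) →
           Graph.Adj (Path (2 ℕ.+ n) ⊠ Path (2 ℕ.+ m)) (vertex u) (vertex v)
      to u v (u≢v , ≉0) =
        let k , (i∈ , j∈) , (i′∈ , j′∈) = ≉0⇒share u v ≉0
        in near⇒strong (u≢v ∘ remQuot-injective (2 ℕ.+ m)) (∈ₑ⇒near i∈ i′∈) (∈ₑ⇒near j∈ j′∈)

      from : ∀ u v → Graph.Adj (Path (2 ℕ.+ n) ⊠ Path (2 ℕ.+ m)) (vertex u) (vertex v) →
             u ≢ v × ¬ (⟨ f u , f v ⟩ K.≈ K.0#)
      from u v adj =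
        -- In each coordinate the two vertices share a full path edge, so they share an interior
        -- clique, and every interior clique is among the chosen ones.
        let near₁ , near₂ = strong⇒near adj
            p , i∈ , i′∈  = near⇒∈ₑ near₁
            q , j∈ , j′∈  = near⇒∈ₑ near₂
            k , eq        = cell-onto-interior lower upper p q
        in (λ u≡v → Graph.irrefl (Path (2 ℕ.+ n) ⊠ Path (2 ℕ.+ m)) (vertex u)
              (≡.subst (Graph.Adj (Path (2 ℕ.+ n) ⊠ Path (2 ℕ.+ m)) (vertex u) ∘ vertex) (≡.sym u≡v) adj)) ,
           share⇒≉0 u v k (≡.subst (vertex u ∈_) (≡.sym eq) (i∈ , j∈))
                          (≡.subst (vertex v ∈_) (≡.sym eq) (i′∈ , j′∈))

  dimension-bounds : ∀ n m → HasDimension d → IsFrameGraphIn H (Path (suc n) ⊠ Path (suc m)) →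
    n ℕ.* m ℕ.≤ d × d ℕ.≤ suc n ℕ.* suc m
  dimension-bounds {d} n m dim (N , f , frame , iso) =
    -- Rows come from the upper corners of the unit cells and columns from the lower corners.
    triangular⇒≤-dimension dim (level ∘ cell)
      (f ∘ at ∘ upper ∘ cell) (f ∘ at ∘ lower ∘ cell) diagonal triangular ,
    ≡.subst (d ℕ.≤_) (↔⇒≡ (↔-sym Finₚ.*↔× ↔-∘ bijection)) (frame⇒dimension≤ dim f frame)
    where
    open _≅_ iso
    at : Fin (suc n) × Fin (suc m) → Fin N
    at = Inverse.from bijection

    at⁻¹ : ∀ u → Inverse.to bijection (at u) ≡ u
    at⁻¹ = Inverse.strictlyInverseˡ bijection

    cell : Fin (n ℕ.* m) → Fin n × Fin m
    cell = remQuot m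

    adj⇒≉0 : ∀ u v → Graph.Adj (Path (suc n) ⊠ Path (suc m)) u v → ¬ (⟨ f (at u) , f (at v) ⟩ K.≈ K.0#)
    adj⇒≉0 u v adj = proj₂ (Equivalence.from (adjacency (at u) (at v))
      (≡.subst₂ (Graph.Adj (Path (suc n) ⊠ Path (suc m))) (≡.sym (at⁻¹ u)) (≡.sym (at⁻¹ v)) adj))

    ≉0⇒near : ∀ u v → ¬ (⟨ f (at u) , f (at v) ⟩ K.≈ K.0#) →
              Near (proj₁ u) (proj₁ v) × Near (proj₂ u) (proj₂ v)
    ≉0⇒near u v ≉0 with at u Finₚ.≟ at v
    -- Adjacency in the frame graph says nothing about equal indices; here the vertices coincide and
    -- are near by reflexivity.
    ... | yes eq with ≡.refl ← ≡.trans (≡.sym (at⁻¹ u)) (≡.trans (≡.cong (Inverse.to bijection) eq) (at⁻¹ v)) =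
      inj₁ ≡.refl , inj₁ ≡.refl
    ... | no ≢ = strong⇒near (≡.subst₂ (Graph.Adj (Path (suc n) ⊠ Path (suc m))) (at⁻¹ u) (at⁻¹ v)
      (Equivalence.to (adjacency (at u) (at v)) (≢ , ≉0)))

    upper lower : Fin n × Fin m → Fin (suc n) × Fin (suc m)
    upper (i , j) = suc i , suc j
    lower (i , j) = inject₁ i , inject₁ j

    diagonal : ∀ k → ¬ (⟨ f (at (upper (cell k))) , f (at (lower (cell k))) ⟩ K.≈ K.0#)
    -- Opposite corners of a unit cell are adjacent by the clause in which both coordinates move.
    diagonal k = adj⇒≉0 _ _ (inj₂ (inj₂ (step _ , step _)))
      where
      step : ∀ {l} (i : Fin l) → Graph.Adj (Path (suc l)) (suc i) (inject₁ i)
      step i = inj₂ (≡.cong suc (≡.sym (Finₚ.toℕ-inject₁ i)))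

    triangular : ∀ q p → ¬ (⟨ f (at (upper (cell q))) , f (at (lower (cell p))) ⟩ K.≈ K.0#) →
                 q ≡ p ⊎ level (cell q) ℕ.< level (cell p)
    triangular q p ≉0 with near₁ , near₂ ← ≉0⇒near _ _ ≉0 =
      Sum⊎.map₁ (remQuot-injective _)
        (componentwise⇒level (near-suc-inject₁⇒≡⊎< near₁) (near-suc-inject₁⇒≡⊎< near₂))

open import Data.Nat.Base using (_*_; _∸_; _≤_)

theorem3p3 : ∀ {c ℓ v e : Level} (ℝ : RealNumbers c ℓ) (𝔽 : Kind)
    (n m d : ℕ) → 2 ≤ n → 2 ≤ m → 1 ≤ d →
    (H : InnerProductSpace ℝ 𝔽 v e) → InnerProductSpace.HasDimension H d →
    IsFrameGraphIn H (Path n ⊠ Path m) ⇔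
    ((n ∸ 1) * (m ∸ 1) ≤ d × d ≤ m * n)
theorem3p3 ℝ 𝔽 (suc (suc n)) (suc (suc m)) d (s≤s (s≤s _)) (s≤s (s≤s _)) _ H dim = mk⇔
  (λ G → let lower , upper = dimension-bounds H (suc n) (suc m) dim G in
         lower , ≡.subst (d ≤_) (ℕₚ.*-comm (2 ℕ.+ n) (2 ℕ.+ m)) upper)
  (λ (lower , upper) → realisation H n m (InnerProducts.orthogonalBasis H dim) lower
                         (≡.subst (d ≤_) (ℕₚ.*-comm (2 ℕ.+ m) (2 ℕ.+ n)) upper))
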